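{- For all $m,n\in\mathbb{N}$, the $q$-analog of the Fibonomial number $$\genfrac{[}{]}{0pt}{0}{m+n}{n}_{\mathcal F}=\frac{[F_{m+n}]_q^!}{[F_m]_q^!\,[F_n]_q^!}$$ is a polynomial in $q$ with non-negative integer coefficients, and it can be computed as $$\genfrac{[}{]}{0pt}{0}{m+n}{n}_{\mathcal F}=\sum_{T\in\mathcal{T}_{m,n}}\omega(T),$$ where $\mathcal{T}_{m,n}$ is the set of path-domino tilings of an $m\times n$ rectangle and $\omega(T)$ is the $q$-weight of $T$.
   Context: $\mathbb{N}=\{1,2,3,\dots\}$. The Fibonacci numbers are $F_0=0$, $F_1=1$, $F_n=F_{n-1}+F_{n-2}$. For $n\in\mathbb{N}$, $[n]_q=1+q+\dots+q^{n-1}$, and $[F_n]_q^!=\prod_{k=1}^n[F_k]_q$. The $m\times n$ rectangle has $m$ columns and $n$ rows of unit cells, with lower-left corner $(0,0)$ and upper-right corner $(m,n)$. A monomino is a single unit cell; a domino consists of two adjacent unit cells, horizontal ($2$ wide, $1$ high) or vertical ($1$ wide, $2$ high). A path-domino tiling of the $m\times n$ rectangle consists of a lattice path from $(0,0)$ to $(m,n)$ with unit north steps $(0,1)$ and unit east steps $(1,0)$, together with a tiling of the rectangle by monominos and dominos (each tile lying entirely above or entirely below the path) such that: (1) all tiles above the path are monominos or horizontal dominos; (2) all tiles below the path are monominos or vertical dominos; (3) every tile that touches the path from below (that is, whose top side is an east step of the path) is a vertical domino. The tiles in (3) are called special vertical dominos. (An east step at height $0$ has no tile below it and gives no condition.)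 $\mathcal{T}_{m,n}$ denotes the set of all path-domino tilings of the $m\times n$ rectangle. $q$-weights of tiles: let $(i,j)$ be the coordinates of the top-right corner of the tile. A monomino has weight $1$; a horizontal domino has weight $q^{F_iF_j}$; a non-special vertical domino has weight $q^{F_iF_j}$; a special vertical domino has weight $q^{F_{i+1}F_j}$. The $q$-weight $\omega(T)$ of $T\in\mathcal{T}_{m,n}$ is the product of the weights of all its tiles. -}

module Defs where

open import Data.Bool using (if_then_else_)
open import Data.Integer as ℤ using (ℤ; 0ℤ; 1ℤ)
import Data.Integer.Properties as ℤ
open import Data.List
  using (List; []; _∷_; [_]; _++_; map; foldr; filter; length; replicate; upTo; cartesianProduct; cartesianProductWith)
open import Data.List.Relation.Unary.All using (All; all?)
open import Data.List.Relation.Unary.Any using (Any; any?)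
open import Data.Nat using (ℕ; zero; suc; _+_; _*_; _≤_; _<_; _≤?_; _<?_; _≟_; NonZero; >-nonZero)
import Data.Nat.Properties as ℕ
open import Data.Product using (∃-syntax; _×_; _,_; uncurry)
open import Data.Sum using (_⊎_)
open import Relation.Binary.Definitions using (DecidableEquality)
open import Relation.Binary.PropositionalEquality using (_≡_; refl; sym; trans; cong; cong₂)
open import Relation.Nullary using (Dec; yes; no; ¬_; does; ¬?)
open import Relation.Nullary.Decidable using (map′; _×-dec_; _⊎-dec_; _→-dec_)

-- ℤ[q]: a polynomial is its list of coefficients, constant term first; since
-- trailing zeros are allowed, equality of polynomials is _≈_ and not _≡_.

Poly : Set
Poly = List ℤ

coeff : Poly → ℕ → ℤ
coeff []      _       = 0ℤ
coeff (a ∷ p) zero    = a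
coeff (a ∷ p) (suc k) = coeff p k

infix  4 _≈_
infixl 6 _⊕_
infixl 7 _⊗_

_≈_ : Poly → Poly → Set
p ≈ r = ∀ k → coeff p k ≡ coeff r k

NonNegativeCoefficients : Poly → Set
NonNegativeCoefficients p = ∀ k → 0ℤ ℤ.≤ coeff p k

0ᴾ 1ᴾ : Poly
0ᴾ = []
1ᴾ = [ 1ℤ ]

_⊕_ : Poly → Poly → Poly
[]      ⊕ r       = r
(a ∷ p) ⊕ []      = a ∷ p
(a ∷ p) ⊕ (b ∷ r) = (a ℤ.+ b) ∷ (p ⊕ r)

_⊗_ : Poly → Poly → Poly
[]      ⊗ r = []
(a ∷ p) ⊗ r = map (a ℤ.*_) r ⊕ (0ℤ ∷ p ⊗ r)

q^_ : ℕ → Poly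
q^ k = replicate k 0ℤ ++ [ 1ℤ ]

∑ ∏ : List Poly → Poly
∑ = foldr _⊕_ 0ᴾ
∏ = foldr _⊗_ 1ᴾ

-- The field of rational functions ℚ(q), as fractions of elements of ℤ[q].

record RationalFunction : Set where
  constructor _/_by_
  field
    numerator   : Poly
    denominator : Poly
    nonzero     : ¬ (denominator ≈ 0ᴾ)

open RationalFunction public

infix 4 _≃_

_≃_ : RationalFunction → RationalFunction → Set
f ≃ g = numerator f ⊗ denominator g ≈ numerator g ⊗ denominator f

1ᴾ≉0ᴾ : ¬ (1ᴾ ≈ 0ᴾ)
1ᴾ≉0ᴾ eq with () ← eq 0

fromPoly : Poly → RationalFunction
fromPoly p = p / 1ᴾ by 1ᴾ≉0ᴾ

fib : ℕ → ℕ
fib zero          = 0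
fib (suc zero)    = 1
fib (suc (suc n)) = fib (suc n) + fib n

-- [ n ]q = 1 + q + ⋯ + qⁿ⁻¹

[_]q : ℕ → Poly
[ n ]q = replicate n 1ℤ

-- [F n ]! is the product of [ fib k ]q over 1 ≤ k ≤ n.

[F_]! : ℕ → Poly
[F n ]! = ∏ (map (λ k → [ fib (suc k) ]q) (upTo n))

coeff-⊗-0 : ∀ p r → coeff (p ⊗ r) 0 ≡ coeff p 0 ℤ.* coeff r 0
coeff-⊗-0 []      r       = refl
coeff-⊗-0 (a ∷ p) []      = sym (ℤ.*-zeroʳ a)
coeff-⊗-0 (a ∷ p) (b ∷ r) = ℤ.+-identityʳ (a ℤ.* b)

fib-suc>0 : ∀ n → 0 < fib (suc n)
fib-suc>0 zero    = ℕ.≤-refl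
fib-suc>0 (suc n) = ℕ.≤-trans (fib-suc>0 n) (ℕ.m≤m+n _ _)

coeff-[]q-0 : ∀ n .{{_ : NonZero n}} → coeff [ n ]q 0 ≡ 1ℤ
coeff-[]q-0 (suc n) = refl

coeff-[F]!-0 : ∀ n → coeff [F n ]! 0 ≡ 1ℤ
coeff-[F]!-0 n = go (upTo n)
  where
  go : ∀ ks → coeff (∏ (map (λ k → [ fib (suc k) ]q) ks)) 0 ≡ 1ℤ
  go []       = refl
  go (k ∷ ks) = trans (coeff-⊗-0 [ fib (suc k) ]q _)
    (cong₂ ℤ._*_ (coeff-[]q-0 (fib (suc k)) {{>-nonZero (fib-suc>0 k)}}) (go ks))

[F]!⊗[F]!≉0ᴾ : ∀ m n → ¬ ([F m ]! ⊗ [F n ]! ≈ 0ᴾ)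
[F]!⊗[F]!≉0ᴾ m n eq
  with () ← trans (sym (eq 0)) (trans (coeff-⊗-0 [F m ]! [F n ]!)
              (cong₂ ℤ._*_ (coeff-[F]!-0 m) (coeff-[F]!-0 n)))

qFibonomial : ℕ → ℕ → RationalFunction
qFibonomial m n = [F m + n ]! / [F m ]! ⊗ [F n ]! by [F]!⊗[F]!≉0ᴾ m n

-- Lattice paths from (0,0) to (m,n), built from their first step to their last.

data Path : ℕ → ℕ → Set where
  start : Path 0 0
  east  : ∀ {m n} → Path m n → Path (suc m) n
  north : ∀ {m n} → Path m n → Path m (suc n)

paths : ∀ m n → List (Path m n)
paths zero    zero    = [ start ]
paths (suc m) zero    = map east (paths m zero)
paths zero    (suc n) = map north (paths zero n)
paths (suc m) (suc n) = map east (paths m (suc n)) ++ map north (paths (suc m) n)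

-- The left end points (a , h) of the east steps (a,h) → (a+1,h) of a path; every
-- column a < m of the rectangle contains exactly one of them.

eastSteps : ∀ {m n} → Path m n → List (ℕ × ℕ)
eastSteps start            = []
eastSteps (east {m} {n} p) = (m , n) ∷ eastSteps p
eastSteps (north p)        = eastSteps p

data Shape : Set where
  monomino horizontal vertical : Shape

_≟ˢ_ : DecidableEquality Shape
monomino   ≟ˢ monomino   = yes refl
monomino   ≟ˢ horizontal = no λ ()
monomino   ≟ˢ vertical   = no λ ()
horizontal ≟ˢ monomino   = no λ ()
horizontal ≟ˢ horizontal = yes refl
horizontal ≟ˢ vertical   = no λ ()
vertical   ≟ˢ monomino   = no λ ()
vertical   ≟ˢ horizontal = no λ ()
vertical   ≟ˢ vertical   = yes refl

width height : Shape → ℕ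
width monomino    = 1
width horizontal  = 2
width vertical    = 1
height monomino   = 1
height horizontal = 1
height vertical   = 2

-- A tile is placed by its lower-left corner (left , bottom); its top-right
-- corner is (right , top).

record Tile : Set where
  constructor tile
  field
    shape  : Shape
    left   : ℕ
    bottom : ℕ

  right top : ℕ
  right = left + width shape
  top   = bottom + height shape

open Tile public

Inside : ℕ → ℕ → Tile → Set
Inside m n t = right t ≤ m × top t ≤ n

inside? : ∀ m n t → Dec (Inside m n t)
inside? m n t = right t ≤? m ×-dec top t ≤? n

-- The unit cells, by their lower-left corners.

cells : ℕ → ℕ → List (ℕ × ℕ)
cells m n = cartesianProduct (upTo m) (upTo n)

Covers : ℕ × ℕ → Tile → Set
Covers (a , b) t = (left t ≤ a × a < right t) × (bottom t ≤ b × b < top t)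

covers? : ∀ c t → Dec (Covers c t)
covers? (a , b) t =
  (left t ≤? a ×-dec a <? right t) ×-dec (bottom t ≤? b ×-dec b <? top t)

CoveredOnce : List Tile → ℕ × ℕ → Set
CoveredOnce ts c = length (filter (covers? c) ts) ≡ 1

module _ {m n : ℕ} (p : Path m n) (t : Tile) where

  -- In each column that the tile meets, it lies above (below) the east step.

  Above : Set
  Above = All (λ (a , h) → left t ≤ a × a < right t → h ≤ bottom t) (eastSteps p)

  Below : Set
  Below = All (λ (a , h) → left t ≤ a × a < right t → top t ≤ h) (eastSteps p)

  TouchesFromBelow : Set
  TouchesFromBelow = Any (λ (a , h) → (left t ≤ a × a < right t) × top t ≡ h) (eastSteps p)

  above? : Dec Above
  above? = all? (λ (a , h) → (left t ≤? a ×-dec a <? right t) →-dec h ≤? bottom t) (eastSteps p)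

  below? : Dec Below
  below? = all? (λ (a , h) → (left t ≤? a ×-dec a <? right t) →-dec top t ≤? h) (eastSteps p)

  touchesFromBelow? : Dec TouchesFromBelow
  touchesFromBelow? =
    any? (λ (a , h) → (left t ≤? a ×-dec a <? right t) ×-dec top t ≟ h) (eastSteps p)

  record Admissible : Set where
    field
      aboveOrBelow       : Above ⊎ Below
      aboveNotVertical   : Above → ¬ shape t ≡ vertical
      belowNotHorizontal : Below → ¬ shape t ≡ horizontal
      touchingVertical   : TouchesFromBelow → shape t ≡ vertical

  admissible? : Dec Admissible
  admissible? = map′
    (λ (x , y , z , w) → record
      { aboveOrBelow = x ; aboveNotVertical = y ; belowNotHorizontal = z ; touchingVertical = w })
    (λ r → let open Admissible r in
      aboveOrBelow , aboveNotVertical , belowNotHorizontal , touchingVertical)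
    ((above? ⊎-dec below?)
      ×-dec (above? →-dec ¬? (shape t ≟ˢ vertical))
      ×-dec (below? →-dec ¬? (shape t ≟ˢ horizontal))
      ×-dec (touchesFromBelow? →-dec shape t ≟ˢ vertical))

record IsPathDominoTiling {m n : ℕ} (p : Path m n) (ts : List Tile) : Set where
  field
    inside     : All (Inside m n) ts
    covered    : All (CoveredOnce ts) (cells m n)
    admissible : All (Admissible p) ts

isPathDominoTiling? : ∀ {m n} (p : Path m n) ts → Dec (IsPathDominoTiling p ts)
isPathDominoTiling? {m} {n} p ts = map′
  (λ (x , y , z) → record { inside = x ; covered = y ; admissible = z })
  (λ r → let open IsPathDominoTiling r in inside , covered , admissible)
  (all? (inside? m n) ts
    ×-dec all? (λ c → length (filter (covers? c) ts) ≟ 1) (cells m n)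
    ×-dec all? (admissible? p) ts)

-- Every tile inside the m × n rectangle, exactly once.

tiles : ℕ → ℕ → List Tile
tiles m n = filter (inside? m n)
  (cartesianProductWith (λ s (a , b) → tile s a b)
    (monomino ∷ horizontal ∷ vertical ∷ []) (cells m n))

sublists : {A : Set} → List A → List (List A)
sublists []       = [ [] ]
sublists (x ∷ xs) = map (x ∷_) (sublists xs) ++ sublists xs

-- The finite set of path-domino tilings, as a list without repetition: a set of
-- tiles is represented by the unique sublist of tiles m n with the same elements.

𝒯 : ∀ m n → List (Path m n × List Tile)
𝒯 m n = filter (uncurry isPathDominoTiling?)
  (cartesianProduct (paths m n) (sublists (tiles m n)))

tileWeight : ∀ {m n} → Path m n → Tile → Poly
tileWeight p t with shape t
... | monomino   = 1ᴾ
... | horizontal = q^ (fib (right t) * fib (top t))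
... | vertical   =
  if does (touchesFromBelow? p t)
  then q^ (fib (suc (right t)) * fib (top t))
  else q^ (fib (right t) * fib (top t))

ω : ∀ {m n} → Path m n × List Tile → Poly
ω (p , ts) = ∏ (map (tileWeight p) ts)

{-# OPTIONS --safe #-}
module Submission where

-- Splitting a path at its last step removes a column below the path (east) or
-- a row above it (north). A row or column of k cells is tiled independently of
-- the rest, and its weighted sum S k satisfies S (k + 2) = S (k + 1) + qˣ S k
-- with x = a F(k+2), hence [a] S k = [a F(k+1)] because [x] + qˣ [y] = [x + y].
-- So the sum G over all tilings satisfies
--   G(m,n) = qˣ ([F(m) F(n-1)] / [F(m)]) G(m-1,n) + ([x] / [F(n)]) G(m,n-1)
-- with x = F(m+1) F(n), and multiplying by [F(m)]! [F(n)]! gives [F(m+n)]!,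
-- since F(m+n) = F(m+1) F(n) + F(m) F(n-1).

-- The tilings are given as a filter of all sublists of all tiles, which has no product structure.
-- Each condition is therefore turned into a factor 0 or 1, and the sum runs over all sublists. For
-- a fixed path the tiles that are not admissible then drop out, and the others can be reordered
-- line by line. The sum factors over these lines because no admissible tile crosses a cut: below
-- the path there is no horizontal domino, above it no vertical one. The special weight is made for
-- the last step of the count. The domino at the top of a column is forced, and its exponent F(m+1)
-- F(n), in place of F(m) F(n), is exactly the number x that the sum over north steps contributes,
-- so that the two sums fit together without a gap. Every such identity is stated after
-- multiplication by its denominator.

open import Defs
open import Algebra.Bundles using (CommutativeMonoid; CommutativeSemiring)
open import Algebra.Structures.Biased using (isCommutativeMonoidˡ; isCommutativeSemiringˡ)
open import Data.Bool using (true; false; if_then_else_)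
open import Data.Integer as ℤ using (ℤ; 0ℤ; 1ℤ)
import Data.Integer.Properties as ℤ
open import Data.List
  using (List; []; _∷_; [_]; _++_; _∷ʳ_; map; filter; length; upTo; cartesianProduct;
    cartesianProductWith)
open import Data.List.Properties
  using (map-++; map-∘; filter-++; filter-none; filter-accept; filter-reject; length-++; upTo-∷ʳ)
open import Data.List.Relation.Binary.Permutation.Propositional
  using (_↭_; refl; prep; swap; trans; ↭-sym)
open import Data.List.Relation.Binary.Permutation.Propositional.Properties
  using (∈-resp-↭; ↭-length; filter-↭)
open import Data.List.Membership.Propositional using (_∈_)
open import Data.List.Membership.Propositional.Properties
  using (∈-upTo⁺; ∈-upTo⁻; ∈-++⁺ˡ; ∈-++⁺ʳ; ∈-filter⁺; ∈-filter⁻;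
    ∈-cartesianProduct⁺; ∈-cartesianProduct⁻; ∈-cartesianProductWith⁺)
open import Data.List.Membership.Propositional.Properties.WithK using (unique∧set⇒bag)
open import Data.List.Relation.Binary.BagAndSetEquality using (∼bag⇒↭)
open import Data.List.Relation.Unary.All as All using (All; []; _∷_; all?)
import Data.List.Relation.Unary.All.Properties as All
open import Data.List.Relation.Unary.AllPairs using ([]; _∷_)
open import Data.List.Relation.Unary.Any using (here; there)
open import Data.List.Relation.Unary.Unique.Propositional using (Unique)
import Data.List.Relation.Unary.Unique.Propositional.Properties as Unique
open import Data.Nat using (ℕ; zero; suc; _+_; _*_; _≤_; _<_; z≤n; s≤s; _≟_; _<?_; NonZero)
import Data.Nat.Properties as ℕ
open import Data.Nat.Tactic.RingSolver using (solve-∀)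
open import Data.Product using (_×_; _,_; ∃-syntax; proj₁; proj₂; uncurry)
open import Data.Sum as Sum using (_⊎_; inj₁; inj₂; [_,_]′)
open import Data.Unit using (tt)
open import Function using (_∘_; _⇔_; mk⇔; Equivalence)
open import Function.Properties.Equivalence using () renaming (refl to ⇔-refl; sym to ⇔-sym)
open import Level using (0ℓ)
open import Relation.Binary.Bundles using (Setoid)
open import Relation.Binary.PropositionalEquality as ≡ using (_≡_; cong; cong₂; subst)
open import Relation.Nullary using (Dec; yes; no; ¬_; does; contradiction)
open import Relation.Nullary.Decidable using (does-⇔; dec-true; dec-false)

-- The semiring ℤ[q]

-- Wrapping _≈_ in a record lets Agda infer the two polynomials from a proof.
infix 4 _≋_
record _≋_ (p r : Poly) : Set where
  constructor coefficientwise
  field equalCoeffs : p ≈ r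

open _≋_

scale : ℤ → Poly → Poly
scale a = map (a ℤ.*_)

coeff-⊕ : ∀ p r k → coeff (p ⊕ r) k ≡ coeff p k ℤ.+ coeff r k
coeff-⊕ []      r       k       = ≡.sym (ℤ.+-identityˡ _)
coeff-⊕ (a ∷ p) []      k       = ≡.sym (ℤ.+-identityʳ _)
coeff-⊕ (a ∷ p) (b ∷ r) zero    = ≡.refl
coeff-⊕ (a ∷ p) (b ∷ r) (suc k) = coeff-⊕ p r k

coeff-scale : ∀ a p k → coeff (scale a p) k ≡ a ℤ.* coeff p k
coeff-scale a []      k       = ≡.sym (ℤ.*-zeroʳ a)
coeff-scale a (b ∷ p) zero    = ≡.refl
coeff-scale a (b ∷ p) (suc k) = coeff-scale a p k

≋-refl : ∀ {p} → p ≋ p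
≋-refl = coefficientwise λ _ → ≡.refl

≋-sym : ∀ {p r} → p ≋ r → r ≋ p
≋-sym e = coefficientwise λ k → ≡.sym (equalCoeffs e k)

≋-trans : ∀ {p r s} → p ≋ r → r ≋ s → p ≋ s
≋-trans e e′ = coefficientwise λ k → ≡.trans (equalCoeffs e k) (equalCoeffs e′ k)

∷-cong : ∀ {a b p r} → a ≡ b → p ≋ r → a ∷ p ≋ b ∷ r
∷-cong a≡b e = coefficientwise λ { zero → a≡b ; (suc k) → equalCoeffs e k }

0∷0ᴾ≋0ᴾ : 0ℤ ∷ [] ≋ 0ᴾ
0∷0ᴾ≋0ᴾ = coefficientwise λ { zero → ≡.refl ; (suc k) → ≡.refl }

⊕-cong : ∀ {p p′ r r′} → p ≋ p′ → r ≋ r′ → p ⊕ r ≋ p′ ⊕ r′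
⊕-cong {p} {p′} {r} {r′} e e′ = coefficientwise λ k →
  ≡.trans (coeff-⊕ p r k)
    (≡.trans (cong₂ ℤ._+_ (equalCoeffs e k) (equalCoeffs e′ k)) (≡.sym (coeff-⊕ p′ r′ k)))

⊕-assoc : ∀ p r s → (p ⊕ r) ⊕ s ≡ p ⊕ (r ⊕ s)
⊕-assoc []      r       s       = ≡.refl
⊕-assoc (a ∷ p) []      s       = ≡.refl
⊕-assoc (a ∷ p) (b ∷ r) []      = ≡.refl
⊕-assoc (a ∷ p) (b ∷ r) (c ∷ s) = cong₂ _∷_ (ℤ.+-assoc a b c) (⊕-assoc p r s)

⊕-comm : ∀ p r → p ⊕ r ≡ r ⊕ p
⊕-comm []      []      = ≡.refl
⊕-comm []      (b ∷ r) = ≡.refl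
⊕-comm (a ∷ p) []      = ≡.refl
⊕-comm (a ∷ p) (b ∷ r) = cong₂ _∷_ (ℤ.+-comm a b) (⊕-comm p r)

≡⇒≋ : ∀ {p r} → p ≡ r → p ≋ r
≡⇒≋ ≡.refl = ≋-refl

⊕-isCommutativeMonoid = isCommutativeMonoidˡ {_≈_ = _≋_} {∙ = _⊕_} {ε = 0ᴾ} (record
  { isSemigroup = record
    { isMagma = record
      { isEquivalence = record { refl = ≋-refl ; sym = ≋-sym ; trans = ≋-trans }
      ; ∙-cong        = ⊕-cong }
    ; assoc = λ p r s → ≡⇒≋ (⊕-assoc p r s) }
  ; identityˡ = λ _ → ≋-refl
  ; comm = λ p r → ≡⇒≋ (⊕-comm p r) })

⊕-commutativeMonoid : CommutativeMonoid 0ℓ 0ℓ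
⊕-commutativeMonoid = record { isCommutativeMonoid = ⊕-isCommutativeMonoid }

open CommutativeMonoid ⊕-commutativeMonoid using (setoid)
  renaming (identityʳ to ⊕-identityʳ; commutativeSemigroup to ⊕-commutativeSemigroup)
open import Algebra.Properties.CommutativeSemigroup ⊕-commutativeSemigroup
  using () renaming (interchange to ⊕-interchange; x∙yz≈y∙xz to ⊕-leftSwap)
open import Relation.Binary.Reasoning.Setoid setoid

scale-cong : ∀ {p r} a → p ≋ r → scale a p ≋ scale a r
scale-cong {p} {r} a e = coefficientwise λ k →
  ≡.trans (coeff-scale a p k)
    (≡.trans (cong (a ℤ.*_) (equalCoeffs e k)) (≡.sym (coeff-scale a r k)))

scale-⊕ : ∀ a p r → scale a (p ⊕ r) ≋ scale a p ⊕ scale a r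
scale-⊕ a []      r       = ≋-refl
scale-⊕ a (b ∷ p) []      = ≋-refl
scale-⊕ a (b ∷ p) (c ∷ r) = ∷-cong (ℤ.*-distribˡ-+ a b c) (scale-⊕ a p r)

scale-scale : ∀ a b p → scale (a ℤ.* b) p ≋ scale a (scale b p)
scale-scale a b []      = ≋-refl
scale-scale a b (c ∷ p) = ∷-cong (ℤ.*-assoc a b c) (scale-scale a b p)

scale-1 : ∀ p → scale 1ℤ p ≋ p
scale-1 []      = ≋-refl
scale-1 (a ∷ p) = ∷-cong (ℤ.*-identityˡ a) (scale-1 p)

scale-0 : ∀ p → scale 0ℤ p ≋ 0ᴾ
scale-0 p = coefficientwise λ k → coeff-scale 0ℤ p k

⊗-congʳ : ∀ p {r s} → r ≋ s → p ⊗ r ≋ p ⊗ s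
⊗-congʳ []      e = ≋-refl
⊗-congʳ (a ∷ p) e = ⊕-cong (scale-cong a e) (∷-cong ≡.refl (⊗-congʳ p e))

⊗-zeroʳ : ∀ p → p ⊗ 0ᴾ ≋ 0ᴾ
⊗-zeroʳ []      = ≋-refl
⊗-zeroʳ (a ∷ p) = ≋-trans (∷-cong ≡.refl (⊗-zeroʳ p)) 0∷0ᴾ≋0ᴾ

-- `_⊗_` recurses on its left factor only. Unfolding the right factor as well is what commutativity
-- needs, and commutativity then supplies the mirror image of each one-sided law.
⊗-∷ : ∀ p b r → p ⊗ (b ∷ r) ≋ scale b p ⊕ (0ℤ ∷ p ⊗ r)
⊗-∷ []      b r = ≋-sym 0∷0ᴾ≋0ᴾ
⊗-∷ (a ∷ p) b r = ∷-cong (cong (ℤ._+ 0ℤ) (ℤ.*-comm a b)) (begin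
  scale a r ⊕ p ⊗ (b ∷ r)                  ≈⟨ ⊕-cong ≋-refl (⊗-∷ p b r) ⟩
  scale a r ⊕ (scale b p ⊕ (0ℤ ∷ p ⊗ r))   ≈⟨ ⊕-leftSwap (scale a r) (scale b p) _ ⟩
  scale b p ⊕ (scale a r ⊕ (0ℤ ∷ p ⊗ r))   ∎)

⊗-comm : ∀ p r → p ⊗ r ≋ r ⊗ p
⊗-comm []      r = ≋-sym (⊗-zeroʳ r)
⊗-comm (a ∷ p) r = begin
  scale a r ⊕ (0ℤ ∷ p ⊗ r)  ≈⟨ ⊕-cong ≋-refl (∷-cong ≡.refl (⊗-comm p r)) ⟩
  scale a r ⊕ (0ℤ ∷ r ⊗ p)  ≈⟨ ⊗-∷ r a p ⟨
  r ⊗ (a ∷ p)               ∎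

⊗-distribˡ-⊕ : ∀ p r s → p ⊗ (r ⊕ s) ≋ p ⊗ r ⊕ p ⊗ s
⊗-distribˡ-⊕ []      r s = ≋-refl
⊗-distribˡ-⊕ (a ∷ p) r s = begin
  scale a (r ⊕ s) ⊕ (0ℤ ∷ p ⊗ (r ⊕ s))
    ≈⟨ ⊕-cong (scale-⊕ a r s) (∷-cong ≡.refl (⊗-distribˡ-⊕ p r s)) ⟩
  (scale a r ⊕ scale a s) ⊕ ((0ℤ ∷ p ⊗ r) ⊕ (0ℤ ∷ p ⊗ s))
    ≈⟨ ⊕-interchange (scale a r) (scale a s) (0ℤ ∷ p ⊗ r) (0ℤ ∷ p ⊗ s) ⟩
  (a ∷ p) ⊗ r ⊕ (a ∷ p) ⊗ s  ∎

⊗-distribʳ-⊕ : ∀ s p r → (p ⊕ r) ⊗ s ≋ p ⊗ s ⊕ r ⊗ s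
⊗-distribʳ-⊕ s p r = begin
  (p ⊕ r) ⊗ s    ≈⟨ ⊗-comm (p ⊕ r) s ⟩
  s ⊗ (p ⊕ r)    ≈⟨ ⊗-distribˡ-⊕ s p r ⟩
  s ⊗ p ⊕ s ⊗ r  ≈⟨ ⊕-cong (⊗-comm s p) (⊗-comm s r) ⟩
  p ⊗ s ⊕ r ⊗ s  ∎

shift-⊗ : ∀ p r → (0ℤ ∷ p) ⊗ r ≋ 0ℤ ∷ p ⊗ r
shift-⊗ p r = ⊕-cong (scale-0 r) ≋-refl

scale-⊗ : ∀ a p r → scale a p ⊗ r ≋ scale a (p ⊗ r)
scale-⊗ a []      r = ≋-refl
scale-⊗ a (b ∷ p) r = begin
  scale (a ℤ.* b) r ⊕ (0ℤ ∷ scale a p ⊗ r)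
    ≈⟨ ⊕-cong (scale-scale a b r) (∷-cong (≡.sym (ℤ.*-zeroʳ a)) (scale-⊗ a p r)) ⟩
  scale a (scale b r) ⊕ scale a (0ℤ ∷ p ⊗ r)
    ≈⟨ scale-⊕ a (scale b r) (0ℤ ∷ p ⊗ r) ⟨
  scale a ((b ∷ p) ⊗ r)  ∎

⊗-assoc : ∀ p r s → (p ⊗ r) ⊗ s ≋ p ⊗ (r ⊗ s)
⊗-assoc []      r s = ≋-refl
⊗-assoc (a ∷ p) r s = begin
  (scale a r ⊕ (0ℤ ∷ p ⊗ r)) ⊗ s
    ≈⟨ ⊗-distribʳ-⊕ s (scale a r) _ ⟩
  scale a r ⊗ s ⊕ (0ℤ ∷ p ⊗ r) ⊗ s
    ≈⟨ ⊕-cong (scale-⊗ a r s) (≋-trans (shift-⊗ (p ⊗ r) s) (∷-cong ≡.refl (⊗-assoc p r s))) ⟩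
  scale a (r ⊗ s) ⊕ (0ℤ ∷ p ⊗ (r ⊗ s))  ∎

⊗-identityˡ : ∀ p → 1ᴾ ⊗ p ≋ p
⊗-identityˡ p = begin
  scale 1ℤ p ⊕ (0ℤ ∷ [])  ≈⟨ ⊕-cong (scale-1 p) 0∷0ᴾ≋0ᴾ ⟩
  p ⊕ []                  ≡⟨ ⊕-comm p [] ⟩
  p                       ∎

⊗-cong : ∀ {p p′ r r′} → p ≋ p′ → r ≋ r′ → p ⊗ r ≋ p′ ⊗ r′
⊗-cong {p} {p′} {r} {r′} e e′ = begin
  p ⊗ r    ≈⟨ ⊗-congʳ p e′ ⟩
  p ⊗ r′   ≈⟨ ⊗-comm p r′ ⟩
  r′ ⊗ p   ≈⟨ ⊗-congʳ r′ e ⟩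
  r′ ⊗ p′  ≈⟨ ⊗-comm r′ p′ ⟩
  p′ ⊗ r′  ∎

ℤ[q] : CommutativeSemiring 0ℓ 0ℓ
ℤ[q] = record { isCommutativeSemiring = isCommutativeSemiringˡ (record
  { +-isCommutativeMonoid = ⊕-isCommutativeMonoid
  ; *-isCommutativeMonoid = isCommutativeMonoidˡ {∙ = _⊗_} {ε = 1ᴾ} (record
    { isSemigroup = record
      { isMagma = record { isEquivalence = Setoid.isEquivalence setoid ; ∙-cong = ⊗-cong }
      ; assoc = ⊗-assoc }
    ; identityˡ = ⊗-identityˡ
    ; comm = ⊗-comm })
  ; distribʳ = ⊗-distribʳ-⊕
  ; zeroˡ = λ _ → ≋-refl {0ᴾ} }) }

open CommutativeSemiring ℤ[q] using ()
  
  renaming (*-identityʳ to ⊗-identityʳ; *-commutativeSemigroup to ⊗-commutativeSemigroup)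
open import Algebra.Properties.CommutativeSemigroup ⊗-commutativeSemigroup
  using () renaming (x∙yz≈y∙xz to ⊗-leftSwap)

⊗-scaleˡ : ∀ p r {s} t → p ⊗ r ≋ s → p ⊗ (t ⊗ r) ≋ t ⊗ s
⊗-scaleˡ p r {s} t e = begin
  p ⊗ (t ⊗ r)  ≈⟨ ⊗-leftSwap p t r ⟩
  t ⊗ (p ⊗ r)  ≈⟨ ⊗-congʳ t e ⟩
  t ⊗ s        ∎

-- This serves twice: in the recurrence along a single line of cells, and at the end, where the east
-- and the north part are added.
[+]q : ∀ a b → [ a + b ]q ≋ [ a ]q ⊕ (q^ a) ⊗ [ b ]q
[+]q zero    b = ≋-sym (⊗-identityˡ [ b ]q)
[+]q (suc a) b = begin
  1ℤ ∷ [ a + b ]q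
    ≈⟨ ∷-cong ≡.refl ([+]q a b) ⟩
  (1ℤ ∷ [ a ]q) ⊕ (0ℤ ∷ (q^ a) ⊗ [ b ]q)
    ≈⟨ ⊕-cong (≋-refl {[ suc a ]q}) (shift-⊗ (q^ a) [ b ]q) ⟨
  [ suc a ]q ⊕ (q^ suc a) ⊗ [ b ]q  ∎

-- Sums over lists and over sublists

∑-++ : ∀ ps rs → ∑ (ps ++ rs) ≡ ∑ ps ⊕ ∑ rs
∑-++ []       rs = ≡.refl
∑-++ (p ∷ ps) rs = ≡.trans (cong (p ⊕_) (∑-++ ps rs)) (≡.sym (⊕-assoc p (∑ ps) (∑ rs)))

∏-++ : ∀ ps rs → ∏ (ps ++ rs) ≋ ∏ ps ⊗ ∏ rs
∏-++ []       rs = ≋-sym (⊗-identityˡ (∏ rs))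
∏-++ (p ∷ ps) rs = ≋-trans (⊗-congʳ p (∏-++ ps rs)) (≋-sym (⊗-assoc p (∏ ps) (∏ rs)))

module _ {A : Set} where

  ∑-cong : ∀ {f g : A → Poly} → (∀ x → f x ≋ g x) → ∀ xs → ∑ (map f xs) ≋ ∑ (map g xs)
  ∑-cong e []       = ≋-refl
  ∑-cong e (x ∷ xs) = ⊕-cong (e x) (∑-cong e xs)

  ∑-⊗ : ∀ p (f : A → Poly) xs → ∑ (map (λ x → p ⊗ f x) xs) ≋ p ⊗ ∑ (map f xs)
  ∑-⊗ p f []       = ≋-sym (⊗-zeroʳ p)
  ∑-⊗ p f (x ∷ xs) =
    ≋-trans (⊕-cong ≋-refl (∑-⊗ p f xs)) (≋-sym (⊗-distribˡ-⊕ p (f x) (∑ (map f xs))))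

  ∏-cong : ∀ {f g : A → Poly} {xs} → All (λ x → f x ≋ g x) xs → ∏ (map f xs) ≋ ∏ (map g xs)
  ∏-cong []       = ≋-refl
  ∏-cong (e ∷ es) = ⊗-cong e (∏-cong es)

  ∏-↭ : ∀ (f : A → Poly) {xs ys} → xs ↭ ys → ∏ (map f xs) ≋ ∏ (map f ys)
  ∏-↭ f refl                         = ≋-refl
  ∏-↭ f (prep x xs↭ys)               = ⊗-congʳ (f x) (∏-↭ f xs↭ys)
  ∏-↭ f (swap {xs} x y xs↭ys)        =
    ≋-trans (⊗-leftSwap (f x) (f y) _) (⊗-congʳ (f y) (⊗-congʳ (f x) (∏-↭ f xs↭ys)))
  ∏-↭ f (trans xs↭ys ys↭zs)          = ≋-trans (∏-↭ f xs↭ys) (∏-↭ f ys↭zs)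

-- An Iverson bracket: a filtered sum becomes a sum over everything, with weight zero where the
-- condition fails.
gate : {P : Set} → Dec P → Poly → Poly
gate P? p = if does P? then p else 0ᴾ

gate-⊥ : {P : Set} (P? : Dec P) (p : Poly) → ¬ P → gate P? p ≋ 0ᴾ
gate-⊥ (yes x) p ¬P = contradiction x ¬P
gate-⊥ (no _)  p ¬P = ≋-refl

gate-⊤ : {P : Set} (P? : Dec P) (p : Poly) → P → gate P? p ≋ p
gate-⊤ (yes _) p x = ≋-refl
gate-⊤ (no ¬x) p x = contradiction x ¬x

gate-cong : {P Q : Set} (P? : Dec P) (Q? : Dec Q) {p r : Poly} →
  (P → Q) → (Q → P) → p ≋ r → gate P? p ≋ gate Q? r
gate-cong (yes x) Q? to from e = ≋-trans e (≋-sym (gate-⊤ Q? _ (to x)))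
gate-cong (no ¬x) Q? to from e = ≋-sym (gate-⊥ Q? _ (¬x ∘ from))

gate-⊗ : {P Q R : Set} (P? : Dec P) (Q? : Dec Q) (R? : Dec R) {p r s : Poly} →
  (R → P × Q) → (P → Q → R) → s ≋ p ⊗ r → gate R? s ≋ gate P? p ⊗ gate Q? r
gate-⊗ (no ¬x) Q?      R?     to from e = gate-⊥ R? _ (¬x ∘ proj₁ ∘ to)
gate-⊗ (yes x) (no ¬y) R? {p} to from e =
  ≋-trans (gate-⊥ R? _ (¬y ∘ proj₂ ∘ to)) (≋-sym (⊗-zeroʳ p))
gate-⊗ (yes x) (yes y) R?     to from e = ≋-trans (gate-⊤ R? _ (from x y)) e

module _ {A : Set} where

  ∑-filter : ∀ {P : A → Set} (P? : ∀ x → Dec (P x)) (f : A → Poly) xs →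
    ∑ (map f (filter P? xs)) ≋ ∑ (map (λ x → gate (P? x) (f x)) xs)
  ∑-filter P? f [] = ≋-refl
  ∑-filter P? f (x ∷ xs) with does (P? x)
  ... | true  = ⊕-cong ≋-refl (∑-filter P? f xs)
  ... | false = ∑-filter P? f xs

  ∑-cartesianProduct : ∀ {B : Set} (f : A × B → Poly) xs ys →
    ∑ (map f (cartesianProduct xs ys)) ≋ ∑ (map (λ x → ∑ (map (λ y → f (x , y)) ys)) xs)
  ∑-cartesianProduct f []       ys = ≋-refl
  ∑-cartesianProduct f (x ∷ xs) ys = begin
    ∑ (map f (map (x ,_) ys ++ cartesianProduct xs ys))
      ≡⟨ cong ∑ (map-++ f (map (x ,_) ys) _) ⟩
    ∑ (map f (map (x ,_) ys) ++ map f (cartesianProduct xs ys))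
      ≡⟨ ∑-++ (map f (map (x ,_) ys)) _ ⟩
    ∑ (map f (map (x ,_) ys)) ⊕ ∑ (map f (cartesianProduct xs ys))
      ≈⟨ ⊕-cong (≡⇒≋ (cong ∑ (≡.sym (map-∘ ys)))) (∑-cartesianProduct f xs ys) ⟩
    ∑ (map (λ y → f (x , y)) ys) ⊕ ∑ (map (λ x → ∑ (map (λ y → f (x , y)) ys)) xs)  ∎

  -- The chosen elements are absorbed into the weight `f`, so inductions on the list generalise over
  -- `f` and never mention the list of all sublists.
  ∑ˢ : (List A → Poly) → List A → Poly
  ∑ˢ f []       = f []
  ∑ˢ f (x ∷ xs) = ∑ˢ (f ∘ (x ∷_)) xs ⊕ ∑ˢ f xs

  ∑-sublists : ∀ f xs → ∑ (map f (sublists xs)) ≋ ∑ˢ f xs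
  ∑-sublists f []       = ⊕-identityʳ (f [])
  ∑-sublists f (x ∷ xs) = begin
    ∑ (map f (map (x ∷_) (sublists xs) ++ sublists xs))
      ≡⟨ cong ∑ (map-++ f (map (x ∷_) (sublists xs)) _) ⟩
    ∑ (map f (map (x ∷_) (sublists xs)) ++ map f (sublists xs))
      ≡⟨ ∑-++ (map f (map (x ∷_) (sublists xs))) _ ⟩
    ∑ (map f (map (x ∷_) (sublists xs))) ⊕ ∑ (map f (sublists xs))
      ≈⟨ ⊕-cong (≋-trans (≡⇒≋ (cong ∑ (≡.sym (map-∘ (sublists xs))))) (∑-sublists (f ∘ (x ∷_)) xs))
           (∑-sublists f xs) ⟩
    ∑ˢ (f ∘ (x ∷_)) xs ⊕ ∑ˢ f xs  ∎

  -- A property of all elements passes to every sublist. `Q` thus carries positional facts about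
  -- tiles to the place where two weights are compared.
  ∑ˢ-cong : ∀ {Q : A → Set} {f g} → (∀ {ts} → All Q ts → f ts ≋ g ts) →
    ∀ {xs} → All Q xs → ∑ˢ f xs ≋ ∑ˢ g xs
  ∑ˢ-cong e []         = e []
  ∑ˢ-cong e (Qx ∷ Qxs) = ⊕-cong (∑ˢ-cong (e ∘ (Qx ∷_)) Qxs) (∑ˢ-cong e Qxs)

  ∑ˢ-0 : ∀ {Q : A → Set} {f} → (∀ {ts} → All Q ts → f ts ≋ 0ᴾ) →
    ∀ {xs} → All Q xs → ∑ˢ f xs ≋ 0ᴾ
  ∑ˢ-0 e []         = e []
  ∑ˢ-0 e (Qx ∷ Qxs) = ⊕-cong (∑ˢ-0 (e ∘ (Qx ∷_)) Qxs) (∑ˢ-0 e Qxs)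

  ∑ˢ-⊗ : ∀ p f xs → ∑ˢ (λ ts → p ⊗ f ts) xs ≋ p ⊗ ∑ˢ f xs
  ∑ˢ-⊗ p f []       = ≋-refl
  ∑ˢ-⊗ p f (x ∷ xs) =
    ≋-trans (⊕-cong (∑ˢ-⊗ p _ xs) (∑ˢ-⊗ p f xs)) (≋-sym (⊗-distribˡ-⊕ p _ (∑ˢ f xs)))

  -- A sublist of a concatenation is a pair of sublists, so a multiplicative weight gives a product
  -- of sums. This is the formal content of tiling two regions independently.
  ∑ˢ-++ : ∀ {Q R : A → Set} {f g h} →
    (∀ {ts us} → All Q ts → All R us → f (ts ++ us) ≋ g ts ⊗ h us) →
    ∀ {xs ys} → All Q xs → All R ys → ∑ˢ f (xs ++ ys) ≋ ∑ˢ g xs ⊗ ∑ˢ h ys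
  ∑ˢ-++ {g = g} {h} e {ys = ys} []         Rys =
    ≋-trans (∑ˢ-cong (e []) Rys) (∑ˢ-⊗ (g []) h ys)
  ∑ˢ-++ {g = g} {h} e {x ∷ xs} {ys} (Qx ∷ Qxs) Rys = ≋-trans
    (⊕-cong (∑ˢ-++ (e ∘ (Qx ∷_)) Qxs Rys) (∑ˢ-++ e Qxs Rys))
    (≋-sym (⊗-distribʳ-⊕ (∑ˢ h ys) (∑ˢ (g ∘ (x ∷_)) xs) (∑ˢ g xs)))

  ∑ˢ-↭ : ∀ {f} → (∀ {ts us} → ts ↭ us → f ts ≋ f us) →
    ∀ {xs ys} → xs ↭ ys → ∑ˢ f xs ≋ ∑ˢ f ys
  ∑ˢ-↭ e refl           = ≋-refl
  ∑ˢ-↭ e (prep x xs↭ys) = ⊕-cong (∑ˢ-↭ (e ∘ prep x) xs↭ys) (∑ˢ-↭ e xs↭ys)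
  ∑ˢ-↭ {f} e {x ∷ y ∷ xs} {y ∷ x ∷ ys} (swap x y xs↭ys) = begin
    (∑ˢ (f ∘ (x ∷_) ∘ (y ∷_)) xs ⊕ ∑ˢ (f ∘ (x ∷_)) xs) ⊕ (∑ˢ (f ∘ (y ∷_)) xs ⊕ ∑ˢ f xs)
      ≈⟨ ⊕-interchange (∑ˢ (f ∘ (x ∷_) ∘ (y ∷_)) xs) _ _ _ ⟩
    (∑ˢ (f ∘ (x ∷_) ∘ (y ∷_)) xs ⊕ ∑ˢ (f ∘ (y ∷_)) xs) ⊕ (∑ˢ (f ∘ (x ∷_)) xs ⊕ ∑ˢ f xs)
      ≈⟨ ⊕-cong (⊕-cong both (∑ˢ-↭ (e ∘ prep y) xs↭ys))
           (⊕-cong (∑ˢ-↭ (e ∘ prep x) xs↭ys) (∑ˢ-↭ e xs↭ys)) ⟩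
    (∑ˢ (f ∘ (y ∷_) ∘ (x ∷_)) ys ⊕ ∑ˢ (f ∘ (y ∷_)) ys) ⊕ (∑ˢ (f ∘ (x ∷_)) ys ⊕ ∑ˢ f ys)  ∎
    where
    -- Of the four choices for `x` and `y`, only the one that takes both sees the swap itself.
    both : ∑ˢ (f ∘ (x ∷_) ∘ (y ∷_)) xs ≋ ∑ˢ (f ∘ (y ∷_) ∘ (x ∷_)) ys
    both = ≋-trans (∑ˢ-cong (λ _ → e (swap x y refl)) (All.universal-U xs))
      (∑ˢ-↭ (e ∘ prep y ∘ prep x) xs↭ys)
  ∑ˢ-↭ e (trans xs↭ys ys↭zs) = ≋-trans (∑ˢ-↭ e xs↭ys) (∑ˢ-↭ e ys↭zs)

  -- An element that fails `Q` makes every sublist containing it vanish, so it can be removed before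
  -- summing.
  ∑ˢ-filter : ∀ {Q : A → Set} (Q? : ∀ x → Dec (Q x)) {f} → (∀ {ts} → ¬ All Q ts → f ts ≋ 0ᴾ) →
    ∀ xs → ∑ˢ f xs ≋ ∑ˢ f (filter Q? xs)
  ∑ˢ-filter Q? e []       = ≋-refl
  ∑ˢ-filter Q? e (x ∷ xs) with Q? x
  ... | yes Qx = ⊕-cong (∑ˢ-filter Q? (λ ¬Qts → e (¬Qts ∘ All.tail)) xs) (∑ˢ-filter Q? e xs)
  ... | no ¬Qx =
    ⊕-cong (∑ˢ-0 (λ _ → e (¬Qx ∘ All.head)) (All.universal-U xs)) (∑ˢ-filter Q? e xs)

-- Tilings of a line of cells

coverings : ℕ × ℕ → List Tile → ℕ
coverings c ts = length (filter (covers? c) ts)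

module _ {c : ℕ × ℕ} where

  coverings-∷⁺ : ∀ {t} ts → Covers c t → coverings c (t ∷ ts) ≡ suc (coverings c ts)
  coverings-∷⁺ ts c∈t = cong length (filter-accept (covers? c) c∈t)

  coverings-∷⁻ : ∀ {t} ts → ¬ Covers c t → coverings c (t ∷ ts) ≡ coverings c ts
  coverings-∷⁻ ts c∉t = cong length (filter-reject (covers? c) c∉t)

  coverings-none : ∀ {ts} → All (λ t → ¬ Covers c t) ts → coverings c ts ≡ 0
  coverings-none c∉ts = cong length (filter-none (covers? c) c∉ts)

  coverings-++ : ∀ ts us → coverings c (ts ++ us) ≡ coverings c ts + coverings c us
  coverings-++ ts us =
    ≡.trans (cong length (filter-++ (covers? c) ts us)) (length-++ (filter (covers? c) ts))

-- Rows above the path and columns below it are the same one-dimensional problem. The parameters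
-- record only which cells of the line a tile covers, and all that follows is derived from that.
module Line (cell : ℕ → ℕ × ℕ) (single double : ℕ → Tile)
  (single-covers  : ∀ {k} → Covers (cell k) (single k))
  (double-coversˡ : ∀ {k} → Covers (cell k) (double k))
  (double-coversʳ : ∀ {k} → Covers (cell (suc k)) (double k))
  (covers-single  : ∀ {k i} → Covers (cell k) (single i) → k ≡ i)
  (covers-double  : ∀ {k i} → Covers (cell k) (double i) → k ≡ i ⊎ k ≡ suc i)
  where

  -- `layer k` collects the tiles whose last cell is `k`. Listing the last cell first lets the
  -- recurrence condition on the tile that covers it.
  layer strip : ℕ → List Tile
  layer zero    = [ single 0 ]
  layer (suc k) = double k ∷ single (suc k) ∷ []
  strip zero    = []
  strip (suc k) = layer k ++ strip k

  strip-All : ∀ {P : Tile → Set} k → (∀ i → i < k → P (single i)) →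
    (∀ i → suc i < k → P (double i)) → All P (strip k)
  strip-All zero          Ps Pd = []
  strip-All (suc zero)    Ps Pd = Ps 0 (s≤s z≤n) ∷ []
  strip-All (suc (suc k)) Ps Pd = Pd k ℕ.≤-refl ∷ Ps (suc k) ℕ.≤-refl ∷
    strip-All (suc k) (λ i i<k → Ps i (ℕ.m≤n⇒m≤1+n i<k)) (λ i i<k → Pd i (ℕ.m≤n⇒m≤1+n i<k))

  single∈strip : ∀ k {i} → i < k → single i ∈ strip k
  single∈strip (suc zero)    (s≤s z≤n) = here ≡.refl
  single∈strip (suc (suc k)) (s≤s i≤k) =
    [ (λ i<k → there (there (single∈strip (suc k) i<k))) , (λ { ≡.refl → there (here ≡.refl) }) ]′
      (ℕ.m≤n⇒m<n∨m≡n i≤k)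

  double∈strip : ∀ k {i} → suc i < k → double i ∈ strip k
  double∈strip (suc zero)    (s≤s ())
  double∈strip (suc (suc k)) (s≤s i≤k) =
    [ (λ i<k → there (there (double∈strip (suc k) i<k))) , (λ { ≡.refl → here ≡.refl }) ]′
      (ℕ.m≤n⇒m<n∨m≡n i≤k)

  Before : ℕ → Tile → Set
  Before k t = ∀ {c} → k ≤ c → ¬ Covers (cell c) t

  strip-Before : ∀ k → All (Before k) (strip k)
  strip-Before k = strip-All k
    (λ i i<k k≤c c∈t → ℕ.<⇒≱ i<k (subst (k ≤_) (covers-single c∈t) k≤c))
    (λ i i<k k≤c c∈t → [ (λ { ≡.refl → ℕ.<⇒≱ i<k (ℕ.m≤n⇒m≤1+n k≤c) }) ,
      (λ { ≡.refl → ℕ.<⇒≱ i<k k≤c }) ]′ (covers-double c∈t))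

  layer-covers : ∀ k → All (Covers (cell k)) (layer k)
  layer-covers zero    = single-covers ∷ []
  layer-covers (suc k) = double-coversʳ ∷ single-covers ∷ []

  layer-unique : ∀ k → Unique (layer k)
  layer-unique zero    = [] ∷ []
  layer-unique (suc k) = (double≢single ∷ []) ∷ [] ∷ []
    where
    double≢single : ¬ double k ≡ single (suc k)
    -- Distinctness has to come from coverage: `double k` covers cell `k`, while `single (suc k)`
    -- covers no cell but `suc k`.
    double≢single eq =
      ℕ.1+n≢n (≡.sym (covers-single {k} (subst (Covers (cell k)) eq double-coversˡ)))

  strip-unique : ∀ k → Unique (strip k)
  strip-unique zero    = []
  strip-unique (suc k) = Unique.++⁺ (layer-unique k) (strip-unique k) λ (t∈layer , t∈strip) →
    All.lookup (strip-Before k) t∈strip ℕ.≤-refl (All.lookup (layer-covers k) t∈layer)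

  Tiled : ℕ → List Tile → Set
  Tiled k ts = All (λ c → CoveredOnce ts (cell c)) (upTo k)

  tiled? : ∀ k ts → Dec (Tiled k ts)
  tiled? k ts = all? (λ c → coverings (cell c) ts ≟ 1) (upTo k)

  tiled⁺ : ∀ {k} ts → (∀ {c} → c < k → CoveredOnce ts (cell c)) → Tiled k ts
  tiled⁺ ts once = All.tabulate (once ∘ ∈-upTo⁻)

  tiled⁻ : ∀ {k c} ts → Tiled k ts → c < k → CoveredOnce ts (cell c)
  tiled⁻ ts tiled c<k = All.lookup tiled (∈-upTo⁺ c<k)

  module _ (w : Tile → Poly) where

    tilingWeight : ℕ → List Tile → Poly
    tilingWeight k ts = gate (tiled? k ts) (∏ (map w ts))

    stripSum : ℕ → Poly
    stripSum k = ∑ˢ (tilingWeight k) (strip k)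

    tilingWeight-uncovered : ∀ k → ∑ˢ (tilingWeight (suc k)) (strip k) ≋ 0ᴾ
    tilingWeight-uncovered k = ∑ˢ-0 (λ {ts} before → gate-⊥ (tiled? (suc k) ts) _ λ tiled →
        ℕ.0≢1+n (≡.trans (≡.sym (coverings-none (All.map (λ b → b ℕ.≤-refl) before)))
          (tiled⁻ ts tiled ℕ.≤-refl)))
      (strip-Before k)

    tilingWeight-overlap : ∀ {k c t u} ts → c < k → Covers (cell c) t → Covers (cell c) u →
      tilingWeight k (t ∷ u ∷ ts) ≋ 0ᴾ
    tilingWeight-overlap {k} {c} {t} {u} ts c<k c∈t c∈u = gate-⊥ (tiled? k (t ∷ u ∷ ts)) _ λ tiled →
      ℕ.1+n≢0 (ℕ.suc-injective (≡.trans (≡.sym (≡.trans (coverings-∷⁺ (u ∷ ts) c∈t)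
        (cong suc (coverings-∷⁺ ts c∈u)))) (tiled⁻ (t ∷ u ∷ ts) tiled c<k)))

    -- The tile `t` fills exactly the cells from `k` up to `l`, and the strip reaches none of these.
    -- So `t` together with `ts` tiles `l` cells if and only if `ts` tiles the first `k`.
    tilingWeight-∷ : ∀ k l t → (∀ {c} → c < k → ¬ Covers (cell c) t) →
      (∀ {c} → k ≤ c → c < l → Covers (cell c) t) → k ≤ l →
      ∑ˢ (tilingWeight l ∘ (t ∷_)) (strip k) ≋ w t ⊗ stripSum k
    tilingWeight-∷ k l t c∉t c∈t k≤l = ≋-trans
      -- The trivial condition `yes tt` leaves the factor `w t` ungated.
      (∑ˢ-cong (λ {ts} before → gate-⊗ (yes tt) (tiled? k ts) (tiled? l (t ∷ ts))
          {w t} {∏ (map w ts)}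
        (λ tiled → tt , tiled⁺ ts λ c<k →
          ≡.trans (≡.sym (coverings-∷⁻ ts (c∉t c<k))) (tiled⁻ (t ∷ ts) tiled (ℕ.<-≤-trans c<k k≤l)))
        (λ _ tiled → tiled⁺ (t ∷ ts) λ {c} c<l → extend before tiled c<l (c <? k))
        ≋-refl) (strip-Before k))
      (∑ˢ-⊗ (w t) (tilingWeight k) (strip k))
      where
      extend : ∀ {ts c} → All (Before k) ts → Tiled k ts → c < l → Dec (c < k) →
        CoveredOnce (t ∷ ts) (cell c)
      extend {ts} before tiled c<l (yes c<k) =
        ≡.trans (coverings-∷⁻ ts (c∉t c<k)) (tiled⁻ ts tiled c<k)
      extend {ts} before tiled c<l (no c≮k) =
        ≡.trans (coverings-∷⁺ ts (c∈t (ℕ.≮⇒≥ c≮k) c<l))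
          (cong suc (coverings-none (All.map (λ b → b (ℕ.≮⇒≥ c≮k)) before)))

    tilingWeight-single : ∀ k →
      ∑ˢ (tilingWeight (suc k) ∘ (single k ∷_)) (strip k) ≋ w (single k) ⊗ stripSum k
    tilingWeight-single k = tilingWeight-∷ k (suc k) (single k)
      (λ c<k c∈t → ℕ.<⇒≢ c<k (covers-single c∈t))
      (λ { k≤c (s≤s c≤k) →
        subst (λ c → Covers (cell c) (single k)) (ℕ.≤-antisym k≤c c≤k) single-covers })
      (ℕ.n≤1+n k)

    tilingWeight-double : ∀ k →
      ∑ˢ (tilingWeight (2 + k) ∘ (double k ∷_)) (strip (suc k)) ≋ w (double k) ⊗ stripSum k
    -- Every tile of `layer k` would cover cell `k` a second time, so only the choices that omit
    -- this layer survive.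
    tilingWeight-double k = ≋-trans (skip (layer-covers k)) (tilingWeight-∷ k (2 + k) (double k)
      (λ c<k c∈t → [ ℕ.<⇒≢ c<k , ℕ.<⇒≢ (ℕ.m≤n⇒m≤1+n c<k) ]′ (covers-double c∈t))
      inside
      (ℕ.m≤n+m k 2))
      where
      skip : ∀ {ts} → All (Covers (cell k)) ts →
        ∑ˢ (tilingWeight (2 + k) ∘ (double k ∷_)) (ts ++ strip k)
          ≋ ∑ˢ (tilingWeight (2 + k) ∘ (double k ∷_)) (strip k)
      skip []           = ≋-refl
      skip {t ∷ ts} (k∈t ∷ k∈ts) = ⊕-cong
        (∑ˢ-0 (λ {us} _ → tilingWeight-overlap us (ℕ.n≤1+n (suc k)) double-coversˡ k∈t)
          (All.universal-U (ts ++ strip k)))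
        (skip k∈ts)
      inside : ∀ {c} → k ≤ c → c < 2 + k → Covers (cell c) (double k)
      inside k≤c (s≤s c≤1+k) with ℕ.m≤n⇒m<n∨m≡n k≤c
      ... | inj₂ ≡.refl = double-coversˡ
      ... | inj₁ k<c    =
        subst (λ c → Covers (cell c) (double k)) (ℕ.≤-antisym k<c c≤1+k) double-coversʳ

    -- Here the top layer lacks its monomino, as in a column under an east step: without the domino
    -- the last cell stays uncovered.
    forcedDouble : ∀ k →
      ∑ˢ (tilingWeight (2 + k)) (double k ∷ strip (suc k)) ≋ w (double k) ⊗ stripSum k
    forcedDouble k = ≋-trans
      (⊕-cong (tilingWeight-double k) (tilingWeight-uncovered (suc k)))
      (⊕-identityʳ _)

    stripSum-1 : stripSum 1 ≋ w (single 0)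
    stripSum-1 = begin
      stripSum 1                 ≈⟨ ⊕-cong (tilingWeight-single 0) (tilingWeight-uncovered 0) ⟩
      w (single 0) ⊗ 1ᴾ ⊕ 0ᴾ    ≈⟨ ⊕-identityʳ _ ⟩
      w (single 0) ⊗ 1ᴾ         ≈⟨ ⊗-identityʳ _ ⟩
      w (single 0)               ∎

    -- Only `double k` and `single (suc k)` cover the last cell. Taking both covers it twice and
    -- taking neither leaves it bare, so two of the four choices remain.
    stripSum-2+ : ∀ k → stripSum (2 + k)
      ≋ w (single (suc k)) ⊗ stripSum (suc k) ⊕ w (double k) ⊗ stripSum k
    stripSum-2+ k = begin
      stripSum (2 + k)
        ≈⟨ ⊕-cong (⊕-cong twiceCovered (tilingWeight-double k))
             (⊕-cong (tilingWeight-single (suc k)) (tilingWeight-uncovered (suc k))) ⟩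
      w (double k) ⊗ stripSum k ⊕ (w (single (suc k)) ⊗ stripSum (suc k) ⊕ 0ᴾ)
        ≈⟨ ⊕-cong (≋-refl {w (double k) ⊗ stripSum k}) (⊕-identityʳ _) ⟩
      w (double k) ⊗ stripSum k ⊕ w (single (suc k)) ⊗ stripSum (suc k)
        ≡⟨ ⊕-comm (w (double k) ⊗ stripSum k) _ ⟩
      w (single (suc k)) ⊗ stripSum (suc k) ⊕ w (double k) ⊗ stripSum k  ∎
      where
      twiceCovered :
        ∑ˢ (tilingWeight (2 + k) ∘ (double k ∷_) ∘ (single (suc k) ∷_)) (strip (suc k)) ≋ 0ᴾ
      twiceCovered = ∑ˢ-0 (λ {ts} _ → tilingWeight-overlap ts ℕ.≤-refl double-coversʳ single-covers)
        (All.universal-U (strip (suc k)))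

    -- Domino weights are prescribed only inside the strip, because in a column the domino directly
    -- above the strip is special and has another weight.
    stripSum-q : (∀ i → w (single i) ≋ 1ᴾ) → ∀ a k →
      (∀ i → suc i < k → w (double i) ≋ (q^ (a * fib (2 + i)))) →
      [ a ]q ⊗ stripSum k ≋ [ a * fib (suc k) ]q
    stripSum-q w-single a zero w-double =
      ≋-trans (⊗-identityʳ [ a ]q) (≡⇒≋ (cong [_]q (≡.sym (ℕ.*-identityʳ a))))
    -- One cell admits a single tiling of weight 1, just like no cell, in accordance with `fib 2`
    -- and `fib 1` both being 1.
    stripSum-q w-single a (suc zero) w-double = ≋-trans
      (⊗-congʳ [ a ]q (≋-trans stripSum-1 (w-single 0)))
      (stripSum-q w-single a zero λ _ ())
    stripSum-q w-single a (suc (suc k)) w-double = begin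
      [ a ]q ⊗ stripSum (2 + k)
        ≈⟨ ⊗-congʳ [ a ]q (stripSum-2+ k) ⟩
      [ a ]q ⊗ (w (single (suc k)) ⊗ stripSum (suc k) ⊕ w (double k) ⊗ stripSum k)
        ≈⟨ ⊗-congʳ [ a ]q (⊕-cong
             (≋-trans (⊗-cong (w-single (suc k)) ≋-refl) (⊗-identityˡ _))
             (⊗-cong (w-double k ℕ.≤-refl) ≋-refl)) ⟩
      [ a ]q ⊗ (stripSum (suc k) ⊕ (q^ x) ⊗ stripSum k)
        ≈⟨ ⊗-distribˡ-⊕ [ a ]q (stripSum (suc k)) _ ⟩
      [ a ]q ⊗ stripSum (suc k) ⊕ [ a ]q ⊗ ((q^ x) ⊗ stripSum k)
        ≈⟨ ⊕-cong (stripSum-q w-single a (suc k) λ i i<k → w-double i (ℕ.m≤n⇒m≤1+n i<k))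
             (⊗-scaleˡ [ a ]q (stripSum k) (q^ x) (stripSum-q w-single a k λ i i<k →
               w-double i (ℕ.m≤n⇒m≤1+n (ℕ.m≤n⇒m≤1+n i<k)))) ⟩
      [ x ]q ⊕ (q^ x) ⊗ [ a * fib (suc k) ]q
        ≈⟨ [+]q x (a * fib (suc k)) ⟨
      [ x + a * fib (suc k) ]q
        ≡⟨ cong [_]q (ℕ.*-distribˡ-+ a (fib (2 + k)) (fib (suc k))) ⟨
      [ a * fib (3 + k) ]q  ∎
      where
      x : ℕ
      x = a * fib (2 + k)

-- The admissible tiles of a path

-- right and top are sums left + width and bottom + height, hence the i + 1 and i + 2.
within-1 : ∀ {k i} → i ≤ k → k < i + 1 → k ≡ i
within-1 {k} {i} i≤k k<i+1 = ℕ.≤-antisym (ℕ.≤-pred (subst (k <_) (ℕ.+-comm i 1) k<i+1)) i≤k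

within-2 : ∀ {k i} → i ≤ k → k < i + 2 → k ≡ i ⊎ k ≡ suc i
within-2 {k} {i} i≤k k<i+2 with ℕ.m≤n⇒m<n∨m≡n i≤k
... | inj₂ i≡k = inj₁ (≡.sym i≡k)
... | inj₁ i<k = inj₂ (ℕ.≤-antisym (ℕ.≤-pred (subst (k <_) (ℕ.+-comm i 2) k<i+2)) i<k)

i<i+1 : ∀ {i} → i < i + 1
i<i+1 {i} = ℕ.m<m+n i (s≤s z≤n)

i<i+2 : ∀ {i} → i < i + 2
i<i+2 {i} = ℕ.m<m+n i (s≤s z≤n)

1+i<i+2 : ∀ {i} → suc i < i + 2
1+i<i+2 {i} = ℕ.≤-reflexive (ℕ.+-comm 2 i)

module Row (j : ℕ) = Line (λ i → i , j) (λ i → tile monomino i j) (λ i → tile horizontal i j)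
  ((ℕ.≤-refl , i<i+1) , (ℕ.≤-refl , i<i+1))
  ((ℕ.≤-refl , i<i+2) , (ℕ.≤-refl , i<i+1))
  ((ℕ.n≤1+n _ , 1+i<i+2) , (ℕ.≤-refl , i<i+1))
  (λ ((i≤k , k<i+1) , _) → within-1 i≤k k<i+1)
  (λ ((i≤k , k<i+2) , _) → within-2 i≤k k<i+2)

module Column (i : ℕ) = Line (λ j → i , j) (λ j → tile monomino i j) (λ j → tile vertical i j)
  ((ℕ.≤-refl , i<i+1) , (ℕ.≤-refl , i<i+1))
  ((ℕ.≤-refl , i<i+1) , (ℕ.≤-refl , i<i+2))
  ((ℕ.≤-refl , i<i+1) , (ℕ.n≤1+n _ , 1+i<i+2))
  (λ (_ , (j≤k , k<j+1)) → within-1 j≤k k<j+1)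
  (λ (_ , (j≤k , k<j+2)) → within-2 j≤k k<j+2)

-- The admissible tiles of column m below its east step at height n: the only
-- one that reaches height n is a vertical domino, which is the special one.
columnTiles : ℕ → ℕ → List Tile
columnTiles m zero          = []
columnTiles m (suc zero)    = []
columnTiles m (suc (suc k)) = tile vertical m k ∷ Column.strip m (suc k)

-- The rectangle is cut into the column under each east step and the row to the left of each north
-- step.
pathTiles : ∀ {m n} → Path m n → List Tile
pathTiles start             = []
pathTiles (east {m} {n} p)  = columnTiles m n ++ pathTiles p
pathTiles (north {m} {n} p) = Row.strip n m ++ pathTiles p

columnTiles-All : ∀ {P : Tile → Set} m n → (∀ i → suc i < n → P (tile monomino m i)) →
  (∀ i → suc i < n → P (tile vertical m i)) → All P (columnTiles m n)
columnTiles-All m zero          Ps Pd = []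
columnTiles-All m (suc zero)    Ps Pd = []
columnTiles-All m (suc (suc k)) Ps Pd = Pd k ℕ.≤-refl ∷
  Column.strip-All m (suc k) (λ i i<k → Ps i (s≤s i<k)) (λ i i<k → Pd i (ℕ.m≤n⇒m≤1+n i<k))

monomino∈columnTiles : ∀ m n {i} → suc i < n → tile monomino m i ∈ columnTiles m n
monomino∈columnTiles m (suc zero)    (s≤s ())
monomino∈columnTiles m (suc (suc k)) (s≤s i<k) = there (Column.single∈strip m (suc k) i<k)

vertical∈columnTiles : ∀ m n {i} → suc i < n → tile vertical m i ∈ columnTiles m n
vertical∈columnTiles m (suc zero)    (s≤s ())
vertical∈columnTiles m (suc (suc k)) (s≤s (s≤s i≤k)) with ℕ.m≤n⇒m<n∨m≡n i≤k
... | inj₁ i<k    = there (Column.double∈strip m (suc k) (s≤s i<k))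
... | inj₂ ≡.refl = here ≡.refl

columnTiles-unique : ∀ m n → Unique (columnTiles m n)
columnTiles-unique m zero          = []
columnTiles-unique m (suc zero)    = []
columnTiles-unique m (suc (suc k)) =
  All.map (λ { before ≡.refl → before ℕ.≤-refl ((ℕ.≤-refl , i<i+1) , (ℕ.n≤1+n k , 1+i<i+2)) })
    (Column.strip-Before m (suc k))
  ∷ Column.strip-unique m (suc k)

left<right : ∀ t → left t < right t
left<right (tile monomino   _ _) = i<i+1
left<right (tile horizontal _ _) = i<i+2
left<right (tile vertical   _ _) = i<i+1

bottom<top : ∀ t → bottom t < top t
bottom<top (tile monomino   _ _) = i<i+1
bottom<top (tile horizontal _ _) = i<i+1
bottom<top (tile vertical   _ _) = i<i+2

eastSteps-bounds : ∀ {m n} (p : Path m n) → All (λ (a , h) → a < m × h ≤ n) (eastSteps p)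
eastSteps-bounds start     = []
eastSteps-bounds (east p)  = (ℕ.≤-refl , ℕ.≤-refl) ∷
  All.map (λ (a<m , h≤n) → ℕ.m≤n⇒m≤1+n a<m , h≤n) (eastSteps-bounds p)
eastSteps-bounds (north p) =
  All.map (λ (a<m , h≤n) → a<m , ℕ.m≤n⇒m≤1+n h≤n) (eastSteps-bounds p)

eastStepOf : ∀ {m n a} (p : Path m n) → a < m → ∃[ h ] (a , h) ∈ eastSteps p
eastStepOf (east p) (s≤s a≤m) with ℕ.m≤n⇒m<n∨m≡n a≤m
... | inj₂ ≡.refl = _ , here ≡.refl
... | inj₁ a<m    = let h , ∈p = eastStepOf p a<m in h , there ∈p
eastStepOf (north p) a<m = eastStepOf p a<m

module _ {m n m′ n′} (p : Path m n) (p′ : Path m′ n′) (t : Tile) where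

  -- Admissibility refers to the path only through these three relations, so it survives a further
  -- step that leaves them unchanged.
  admissible-resp : Above p t ⇔ Above p′ t → Below p t ⇔ Below p′ t →
    TouchesFromBelow p t ⇔ TouchesFromBelow p′ t → Admissible p t → Admissible p′ t
  admissible-resp above below touches adm = record
    { aboveOrBelow       = Sum.map (to above) (to below) aboveOrBelow
    ; aboveNotVertical   = aboveNotVertical ∘ from above
    ; belowNotHorizontal = belowNotHorizontal ∘ from below
    ; touchingVertical   = touchingVertical ∘ from touches }
    where
    open Admissible adm
    open Equivalence

module _ {m n} (p : Path m n) (t : Tile) where

  module _ (r≤m : right t ≤ m) where

    private
      m∉t : {A : Set} → left t ≤ m × m < right t → A
      m∉t (_ , m<r) = contradiction r≤m (ℕ.<⇒≱ m<r)

    above-east : Above (east p) t ⇔ Above p t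
    above-east = mk⇔ All.tail (m∉t ∷_)

    below-east : Below (east p) t ⇔ Below p t
    below-east = mk⇔ All.tail (m∉t ∷_)

    touches-east : TouchesFromBelow (east p) t ⇔ TouchesFromBelow p t
    touches-east = mk⇔ (λ { (here (m∈t , _)) → m∉t m∈t ; (there touches) → touches }) there

    admissible-east⁺ : Admissible p t → Admissible (east p) t
    admissible-east⁺ = admissible-resp p (east p) t
      (⇔-sym above-east) (⇔-sym below-east) (⇔-sym touches-east)

    admissible-east⁻ : Admissible (east p) t → Admissible p t
    admissible-east⁻ = admissible-resp (east p) p t above-east below-east touches-east

  admissible-north⁺ : Admissible p t → Admissible (north p) t
  admissible-north⁺ = admissible-resp p (north p) t ⇔-refl ⇔-refl ⇔-refl

  admissible-north⁻ : Admissible (north p) t → Admissible p t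
  admissible-north⁻ = admissible-resp (north p) p t ⇔-refl ⇔-refl ⇔-refl

  -- Earlier east steps lie in columns left of `m`, which the tile does not meet, so the step at
  -- height `n` decides everything. With its top at most `n` the tile is never above that step.
  lastColumn-admissible : left t ≡ m → top t ≤ n → ¬ shape t ≡ horizontal →
    (top t ≡ n → shape t ≡ vertical) → Admissible (east p) t
  lastColumn-admissible l≡m t≤n ¬horizontal touching = record
    { aboveOrBelow       = inj₂ ((λ _ → t≤n) ∷ All.map elsewhere (eastSteps-bounds p))
    ; aboveNotVertical   = λ above → contradiction (All.head above m∈t)
                             (ℕ.<⇒≱ (ℕ.<-≤-trans (bottom<top t) t≤n))
    ; belowNotHorizontal = λ _ → ¬horizontal
    ; touchingVertical   = λ
      { (here (_ , t≡n)) → touching t≡n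
      ; (there touches)  → let bounds , a∈t , _ = All.lookupAny (eastSteps-bounds p) touches
                           in elsewhere bounds a∈t } }
    where
    m∈t : left t ≤ m × m < right t
    m∈t = ℕ.≤-reflexive l≡m , subst (_< right t) l≡m (left<right t)
    elsewhere : ∀ {a h} {A : Set} → a < m × h ≤ n → left t ≤ a × a < right t → A
    elsewhere {a} (a<m , _) (l≤a , _) = contradiction l≤a (ℕ.<⇒≱ (subst (a <_) (≡.sym l≡m) a<m))

  -- The tile meets some column of the rectangle, and the east step there has height at most `n`.
  notBelow : right t ≤ m → n < top t → ¬ Below p t
  notBelow r≤m n<t below =
    let h , step = eastStepOf p (ℕ.<-≤-trans (left<right t) r≤m)
        t≤h = All.lookup below step (ℕ.≤-refl , left<right t)
    in ℕ.<⇒≱ n<t (ℕ.≤-trans t≤h (proj₂ (All.lookup (eastSteps-bounds p) step)))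

  lastRow-admissible : right t ≤ m → bottom t ≡ n → ¬ shape t ≡ vertical → Admissible (north p) t
  lastRow-admissible r≤m b≡n ¬vertical = record
    { aboveOrBelow       = inj₁ (All.map (λ (_ , h≤n) _ → subst (_ ≤_) (≡.sym b≡n) h≤n)
                             (eastSteps-bounds p))
    ; aboveNotVertical   = λ _ → ¬vertical
    ; belowNotHorizontal = λ below _ → notBelow r≤m n<t below
    ; touchingVertical   = λ touches →
        let (_ , h≤n) , _ , t≡h = All.lookupAny (eastSteps-bounds p) touches
        in contradiction (subst (_≤ n) (≡.sym t≡h) h≤n) (ℕ.<⇒≱ n<t) }
    where
    n<t : n < top t
    n<t = subst (_< top t) b≡n (bottom<top t)

i+1≤ : ∀ {i k} → i < k → i + 1 ≤ k
i+1≤ {i} {k} = subst (_≤ k) (ℕ.+-comm 1 i)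

i+2≤ : ∀ {i k} → suc i < k → i + 2 ≤ k
i+2≤ {i} {k} = subst (_≤ k) (ℕ.+-comm 2 i)

i+1≤⁻ : ∀ {i k} → i + 1 ≤ k → i < k
i+1≤⁻ {i} {k} = subst (_≤ k) (ℕ.+-comm i 1)

i+2≤⁻ : ∀ {i k} → i + 2 ≤ k → suc i < k
i+2≤⁻ {i} {k} = subst (_≤ k) (ℕ.+-comm i 2)

i+1≡⁻ : ∀ {i k} → i + 1 ≡ suc k → i ≡ k
i+1≡⁻ {i} eq = ℕ.suc-injective (≡.trans (ℕ.+-comm 1 i) eq)

pathTiles-sound : ∀ {m n} (p : Path m n) → All (λ t → Inside m n t × Admissible p t) (pathTiles p)
pathTiles-sound start = []
pathTiles-sound (east {m} {n} p) = All.++⁺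
  (columnTiles-All m n
    (λ b b<n → (i+1≤ ℕ.≤-refl , i+1≤ (ℕ.<⇒≤ b<n)) ,
      lastColumn-admissible p _ ≡.refl (i+1≤ (ℕ.<⇒≤ b<n)) (λ ())
        (λ b+1≡n → contradiction (≡.trans (ℕ.+-comm 1 b) b+1≡n) (ℕ.<⇒≢ b<n)))
    (λ b b<n → (i+1≤ ℕ.≤-refl , i+2≤ b<n) ,
      lastColumn-admissible p _ ≡.refl (i+2≤ b<n) (λ ()) (λ _ → ≡.refl)))
  (All.map (λ {t} ((r≤m , t≤n) , adm) → (ℕ.m≤n⇒m≤1+n r≤m , t≤n) , admissible-east⁺ p t r≤m adm)
    (pathTiles-sound p))
pathTiles-sound (north {m} {n} p) = All.++⁺
  (Row.strip-All n m
    (λ a a<m → (i+1≤ a<m , i+1≤ ℕ.≤-refl) , lastRow-admissible p _ (i+1≤ a<m) ≡.refl (λ ()))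
    (λ a a<m → (i+2≤ a<m , i+1≤ ℕ.≤-refl) , lastRow-admissible p _ (i+2≤ a<m) ≡.refl (λ ())))
  (All.map (λ {t} ((r≤m , t≤n) , adm) → (r≤m , ℕ.m≤n⇒m≤1+n t≤n) , admissible-north⁺ p t adm)
    (pathTiles-sound p))

-- After an east step, a tile that reaches the last column cannot be above the path, hence is not
-- horizontal and has width 1. After a north step, a tile that reaches the top row cannot be below,
-- hence is not vertical and has height 1. All other tiles lie in the smaller rectangle.
pathTiles-complete : ∀ {m n} (p : Path m n) t → Inside m n t → Admissible p t → t ∈ pathTiles p
pathTiles-complete start t (r≤0 , _) adm = contradiction (ℕ.<-≤-trans (left<right t) r≤0) λ ()
pathTiles-complete (east {m} {n} p) t (r≤1+m , t≤n) adm with ℕ.m≤n⇒m<n∨m≡n r≤1+m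
... | inj₁ (s≤s r≤m) = ∈-++⁺ʳ (columnTiles m n)
  (pathTiles-complete p t (r≤m , t≤n) (admissible-east⁻ p t r≤m adm))
... | inj₂ r≡1+m = ∈-++⁺ˡ (inColumn t t≤n r≡1+m ¬horizontal touchingVertical)
  where
  open Admissible adm
  m∈t : left t ≤ m × m < right t
  m∈t = ℕ.≤-pred (subst (left t <_) r≡1+m (left<right t)) , ℕ.≤-reflexive (≡.sym r≡1+m)
  ¬horizontal : ¬ shape t ≡ horizontal
  ¬horizontal = [ (λ above → contradiction (All.head above m∈t)
      (ℕ.<⇒≱ (ℕ.<-≤-trans (bottom<top t) t≤n))) , belowNotHorizontal ]′ aboveOrBelow
  inColumn : ∀ t → top t ≤ n → right t ≡ suc m → ¬ shape t ≡ horizontal →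
    (TouchesFromBelow (east p) t → shape t ≡ vertical) → t ∈ columnTiles m n
  inColumn (tile horizontal a b) t≤n r≡ ¬h touching = contradiction ≡.refl ¬h
  inColumn (tile vertical   a b) t≤n r≡ ¬h touching with ≡.refl ← i+1≡⁻ {a} r≡ =
    vertical∈columnTiles m n (i+2≤⁻ t≤n)
  inColumn (tile monomino   a b) t≤n r≡ ¬h touching with ≡.refl ← i+1≡⁻ {a} r≡
    with ℕ.m≤n⇒m<n∨m≡n t≤n
  ... | inj₁ t<n = monomino∈columnTiles m n (subst (_< n) (ℕ.+-comm b 1) t<n)
  -- A monomino at height `n` would touch the path from below.
  ... | inj₂ t≡n with () ← touching (here ((ℕ.≤-refl , i<i+1) , t≡n))
pathTiles-complete (north {m} {n} p) t (r≤m , t≤1+n) adm with ℕ.m≤n⇒m<n∨m≡n t≤1+n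
... | inj₁ (s≤s t≤n) = ∈-++⁺ʳ (Row.strip n m)
  (pathTiles-complete p t (r≤m , t≤n) (admissible-north⁻ p t adm))
... | inj₂ t≡1+n = ∈-++⁺ˡ (inRow t r≤m t≡1+n ¬vertical)
  where
  open Admissible adm
  ¬vertical : ¬ shape t ≡ vertical
  ¬vertical = [ aboveNotVertical ,
    (λ below → contradiction below (notBelow p t r≤m (ℕ.≤-reflexive (≡.sym t≡1+n)))) ]′ aboveOrBelow
  inRow : ∀ t → right t ≤ m → top t ≡ suc n → ¬ shape t ≡ vertical → t ∈ Row.strip n m
  inRow (tile vertical   a b) r≤m t≡ ¬v = contradiction ≡.refl ¬v
  inRow (tile monomino   a b) r≤m t≡ ¬v with ≡.refl ← i+1≡⁻ {b} t≡ =
    Row.single∈strip n m (i+1≤⁻ r≤m)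
  inRow (tile horizontal a b) r≤m t≡ ¬v with ≡.refl ← i+1≡⁻ {b} t≡ =
    Row.double∈strip n m (i+2≤⁻ r≤m)

columnTiles-left : ∀ m n → All (λ t → m ≤ left t) (columnTiles m n)
columnTiles-left m n = columnTiles-All m n (λ _ _ → ℕ.≤-refl) (λ _ _ → ℕ.≤-refl)

rowTiles-bottom : ∀ m n → All (λ t → n ≤ bottom t) (Row.strip n m)
rowTiles-bottom m n = Row.strip-All n m (λ _ _ → ℕ.≤-refl) (λ _ _ → ℕ.≤-refl)

pathTiles-inside : ∀ {m n} (p : Path m n) → All (Inside m n) (pathTiles p)
pathTiles-inside p = All.map proj₁ (pathTiles-sound p)

pathTiles-unique : ∀ {m n} (p : Path m n) → Unique (pathTiles p)
pathTiles-unique start = []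
pathTiles-unique (east {m} {n} p) = Unique.++⁺ (columnTiles-unique m n) (pathTiles-unique p)
  λ {t} (t∈column , t∈p) → ℕ.<⇒≱ (left<right t)
    (ℕ.≤-trans (proj₁ (All.lookup (pathTiles-inside p) t∈p))
      (All.lookup (columnTiles-left m n) t∈column))
pathTiles-unique (north {m} {n} p) = Unique.++⁺ (Row.strip-unique n m) (pathTiles-unique p)
  λ {t} (t∈row , t∈p) → ℕ.<⇒≱ (bottom<top t)
    (ℕ.≤-trans (proj₂ (All.lookup (pathTiles-inside p) t∈p))
      (All.lookup (rowTiles-bottom m n) t∈row))

tiles-inside : ∀ m n → All (Inside m n) (tiles m n)
tiles-inside m n = All.all-filter (inside? m n)
  (cartesianProductWith (λ s (a , b) → tile s a b)
    (monomino ∷ horizontal ∷ vertical ∷ []) (cells m n))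

tiles-complete : ∀ m n t → Inside m n t → t ∈ tiles m n
tiles-complete m n t@(tile s a b) inside@(r≤m , t≤n) = ∈-filter⁺ (inside? m n)
  (∈-cartesianProductWith⁺ (λ s (a , b) → tile s a b) (shape∈ s)
    (∈-cartesianProduct⁺ (∈-upTo⁺ (ℕ.<-≤-trans (left<right t) r≤m))
      (∈-upTo⁺ (ℕ.<-≤-trans (bottom<top t) t≤n))))
  inside
  where
  shape∈ : ∀ s → s ∈ monomino ∷ horizontal ∷ vertical ∷ []
  shape∈ monomino   = here ≡.refl
  shape∈ horizontal = there (here ≡.refl)
  shape∈ vertical   = there (there (here ≡.refl))

tiles-unique : ∀ m n → Unique (tiles m n)
tiles-unique m n = Unique.filter⁺ (inside? m n)
  (Unique.cartesianProductWith⁺ (λ s (a , b) → tile s a b) (λ { ≡.refl → ≡.refl , ≡.refl })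
    (((λ ()) ∷ (λ ()) ∷ []) ∷ ((λ ()) ∷ []) ∷ [] ∷ [])
    (Unique.cartesianProduct⁺ (Unique.upTo⁺ m) (Unique.upTo⁺ n)))

-- Two lists without repetition and with the same members are permutations of each other. This
-- trades the enumeration by shape and cell for the one along the path.
admissibleTiles-↭ : ∀ {m n} (p : Path m n) → filter (admissible? p) (tiles m n) ↭ pathTiles p
admissibleTiles-↭ {m} {n} p = ∼bag⇒↭ (unique∧set⇒bag
  (Unique.filter⁺ (admissible? p) (tiles-unique m n)) (pathTiles-unique p)
  λ {t} → mk⇔
    (λ t∈ → let t∈tiles , adm = ∈-filter⁻ (admissible? p) t∈
            in pathTiles-complete p t (All.lookup (tiles-inside m n) t∈tiles) adm)
    (λ t∈ → let inside , adm = All.lookup (pathTiles-sound p) t∈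
            in ∈-filter⁺ (admissible? p) (tiles-complete m n t inside) adm))

-- Splitting off the last row or column

Covered : ℕ → ℕ → List Tile → Set
Covered m n ts = All (CoveredOnce ts) (cells m n)

covered? : ∀ m n ts → Dec (Covered m n ts)
covered? m n ts = all? (λ c → coverings c ts ≟ 1) (cells m n)

covered⁺ : ∀ m n ts → (∀ {a b} → a < m → b < n → CoveredOnce ts (a , b)) → Covered m n ts
covered⁺ m n ts once = All.tabulate λ c∈ →
  let a∈ , b∈ = ∈-cartesianProduct⁻ (upTo m) (upTo n) c∈ in once (∈-upTo⁻ a∈) (∈-upTo⁻ b∈)

covered⁻ : ∀ m n ts → Covered m n ts → ∀ {a b} → a < m → b < n → CoveredOnce ts (a , b)
covered⁻ m n ts covered a<m b<n =
  All.lookup covered (∈-cartesianProduct⁺ (∈-upTo⁺ a<m) (∈-upTo⁺ b<n))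

coverings-++ˡ : ∀ {c} ts us → All (λ t → ¬ Covers c t) us → coverings c (ts ++ us) ≡ coverings c ts
coverings-++ˡ {c} ts us c∉us = ≡.trans (coverings-++ ts us)
  (≡.trans (cong (coverings c ts +_) (coverings-none c∉us)) (ℕ.+-identityʳ _))

coverings-++ʳ : ∀ {c} ts us → All (λ t → ¬ Covers c t) ts → coverings c (ts ++ us) ≡ coverings c us
coverings-++ʳ {c} ts us c∉ts = ≡.trans (coverings-++ ts us)
  (cong (_+ coverings c us) (coverings-none c∉ts))

module _ {m n} (p : Path m n) where

  pathWeight : List Tile → Poly
  pathWeight ts = gate (covered? m n ts) (∏ (map (tileWeight p) ts))

  pathSum : Poly
  pathSum = ∑ˢ pathWeight (pathTiles p)

  pathWeight-↭ : ∀ {ts us} → ts ↭ us → pathWeight ts ≋ pathWeight us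
  pathWeight-↭ {ts} {us} ts↭us = gate-cong (covered? m n ts) (covered? m n us)
    (All.map (λ {c} → ≡.trans (coverings-↭ c (↭-sym ts↭us))))
    (All.map (λ {c} → ≡.trans (coverings-↭ c ts↭us)))
    (∏-↭ (tileWeight p) ts↭us)
    where
    coverings-↭ : ∀ c {ts us} → ts ↭ us → coverings c ts ≡ coverings c us
    coverings-↭ c ts↭us = ↭-length (filter-↭ (covers? c) ts↭us)

  -- Once the inadmissible tiles are gone, all remaining tiles are inside and admissible, and
  -- covering is the only condition left to gate.
  ∑-tilings : ∑ˢ (λ ts → gate (isPathDominoTiling? p ts) (ω (p , ts))) (tiles m n) ≋ pathSum
  ∑-tilings = begin
    ∑ˢ (λ ts → gate (isPathDominoTiling? p ts) (ω (p , ts))) (tiles m n)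
      ≈⟨ ∑ˢ-filter (admissible? p) (λ {ts} ¬adm → gate-⊥ (isPathDominoTiling? p ts) _
           (¬adm ∘ IsPathDominoTiling.admissible)) (tiles m n) ⟩
    ∑ˢ (λ ts → gate (isPathDominoTiling? p ts) (ω (p , ts))) (filter (admissible? p) (tiles m n))
      ≈⟨ ∑ˢ-cong (λ {ts} good → gate-cong (isPathDominoTiling? p ts) (covered? m n ts)
             IsPathDominoTiling.covered
             (λ covered → record
               { inside = All.map proj₁ good
               ; covered = covered
               ; admissible = All.map proj₂ good })
             ≋-refl)
           (All.tabulate λ t∈ →
             All.lookup (pathTiles-sound p) (∈-resp-↭ (admissibleTiles-↭ p) t∈)) ⟩
    ∑ˢ pathWeight (filter (admissible? p) (tiles m n))
      ≈⟨ ∑ˢ-↭ pathWeight-↭ (admissibleTiles-↭ p) ⟩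
    pathSum  ∎

  columnSum : Poly
  columnSum = ∑ˢ (Column.tilingWeight m (tileWeight (east p)) n) (columnTiles m n)

  rowSum : Poly
  rowSum = Row.stripSum n (tileWeight (north p)) m

tileWeight-east : ∀ {m n} (p : Path m n) t → right t ≤ m →
  tileWeight (east p) t ≡ tileWeight p t
tileWeight-east p (tile monomino   _ _) r≤m = ≡.refl
tileWeight-east p (tile horizontal _ _) r≤m = ≡.refl
tileWeight-east p t@(tile vertical a b) r≤m = cong
  (λ touches → if touches then q^ (fib (suc (right t)) * fib (top t))
                          else (q^ (fib (right t) * fib (top t))))
  (does-⇔ (touches-east p t r≤m) (touchesFromBelow? (east p) t) (touchesFromBelow? p t))

tileWeight-north : ∀ {m n} (p : Path m n) t → tileWeight (north p) t ≡ tileWeight p t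
tileWeight-north p (tile monomino   _ _) = ≡.refl
tileWeight-north p (tile horizontal _ _) = ≡.refl
tileWeight-north p (tile vertical   _ _) = ≡.refl

-- The new column's tiles start no earlier than `m` and the others end by `m`, so each cell is
-- covered from one group only. Covering and weight are therefore multiplicative.
pathSum-east : ∀ {m n} (p : Path m n) → pathSum (east p) ≋ columnSum p ⊗ pathSum p
pathSum-east {m} {n} p = ∑ˢ-++ split (columnTiles-left m n) (pathTiles-inside p)
  where
  w = tileWeight (east p)
  split : ∀ {ts us} → All (λ t → m ≤ left t) ts → All (Inside m n) us →
    pathWeight (east p) (ts ++ us) ≋ Column.tilingWeight m w n ts ⊗ pathWeight p us
  split {ts} {us} ts-right us-inside =
    gate-⊗ (Column.tiled? m n ts) (covered? m n us) (covered? (suc m) n (ts ++ us))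
      {∏ (map w ts)} {∏ (map (tileWeight p) us)}
      (λ covered →
        Column.tiled⁺ m ts (λ b<n → ≡.trans (≡.sym inColumn)
          (covered⁻ (suc m) n (ts ++ us) covered ℕ.≤-refl b<n)) ,
        covered⁺ m n us (λ a<m b<n → ≡.trans (≡.sym (beforeColumn a<m))
          (covered⁻ (suc m) n (ts ++ us) covered (ℕ.m≤n⇒m≤1+n a<m) b<n)))
      (λ tiled covered → covered⁺ (suc m) n (ts ++ us) λ { (s≤s a≤m) b<n →
        [ (λ a<m → ≡.trans (beforeColumn a<m) (covered⁻ m n us covered a<m b<n))
        , (λ { ≡.refl → ≡.trans inColumn (Column.tiled⁻ m ts tiled b<n) }) ]′ (ℕ.m≤n⇒m<n∨m≡n a≤m) })
      (begin
        ∏ (map w (ts ++ us))                          ≡⟨ cong ∏ (map-++ w ts us) ⟩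
        ∏ (map w ts ++ map w us)                      ≈⟨ ∏-++ (map w ts) (map w us) ⟩
        ∏ (map w ts) ⊗ ∏ (map w us)
          ≈⟨ ⊗-congʳ (∏ (map w ts))
               (∏-cong (All.map (λ {t} (r≤m , _) → ≡⇒≋ (tileWeight-east p t r≤m)) us-inside)) ⟩
        ∏ (map w ts) ⊗ ∏ (map (tileWeight p) us)  ∎)
    where
    inColumn : ∀ {b} → coverings (m , b) (ts ++ us) ≡ coverings (m , b) ts
    inColumn = coverings-++ˡ ts us
      (All.map (λ (r≤m , _) ((_ , m<r) , _) → ℕ.<⇒≱ m<r r≤m) us-inside)
    beforeColumn : ∀ {a b} → a < m → coverings (a , b) (ts ++ us) ≡ coverings (a , b) us
    beforeColumn a<m = coverings-++ʳ ts us
      (All.map (λ m≤l ((l≤a , _) , _) → ℕ.<⇒≱ a<m (ℕ.≤-trans m≤l l≤a)) ts-right)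

pathSum-north : ∀ {m n} (p : Path m n) → pathSum (north p) ≋ rowSum p ⊗ pathSum p
pathSum-north {m} {n} p = ∑ˢ-++ split (rowTiles-bottom m n) (pathTiles-inside p)
  where
  w = tileWeight (north p)
  split : ∀ {ts us} → All (λ t → n ≤ bottom t) ts → All (Inside m n) us →
    pathWeight (north p) (ts ++ us) ≋ Row.tilingWeight n w m ts ⊗ pathWeight p us
  split {ts} {us} ts-above us-inside =
    gate-⊗ (Row.tiled? n m ts) (covered? m n us) (covered? m (suc n) (ts ++ us))
      {∏ (map w ts)} {∏ (map (tileWeight p) us)}
      (λ covered →
        Row.tiled⁺ n ts (λ a<m → ≡.trans (≡.sym inRow)
          (covered⁻ m (suc n) (ts ++ us) covered a<m ℕ.≤-refl)) ,
        covered⁺ m n us (λ a<m b<n → ≡.trans (≡.sym (belowRow b<n))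
          (covered⁻ m (suc n) (ts ++ us) covered a<m (ℕ.m≤n⇒m≤1+n b<n))))
      (λ tiled covered → covered⁺ m (suc n) (ts ++ us) λ { a<m (s≤s b≤n) →
        [ (λ b<n → ≡.trans (belowRow b<n) (covered⁻ m n us covered a<m b<n))
        , (λ { ≡.refl → ≡.trans inRow (Row.tiled⁻ n ts tiled a<m) }) ]′ (ℕ.m≤n⇒m<n∨m≡n b≤n) })
      (begin
        ∏ (map w (ts ++ us))                          ≡⟨ cong ∏ (map-++ w ts us) ⟩
        ∏ (map w ts ++ map w us)                      ≈⟨ ∏-++ (map w ts) (map w us) ⟩
        ∏ (map w ts) ⊗ ∏ (map w us)
          ≈⟨ ⊗-congʳ (∏ (map w ts))
               (∏-cong (All.universal (λ t → ≡⇒≋ (tileWeight-north p t)) us)) ⟩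
        ∏ (map w ts) ⊗ ∏ (map (tileWeight p) us)  ∎)
    where
    inRow : ∀ {a} → coverings (a , n) (ts ++ us) ≡ coverings (a , n) ts
    inRow = coverings-++ˡ ts us
      (All.map (λ (_ , t≤n) (_ , (_ , n<t)) → ℕ.<⇒≱ n<t t≤n) us-inside)
    belowRow : ∀ {a b} → b < n → coverings (a , b) (ts ++ us) ≡ coverings (a , b) us
    belowRow b<n = coverings-++ʳ ts us
      (All.map (λ n≤l (_ , (l≤b , _)) → ℕ.<⇒≱ b<n (ℕ.≤-trans n≤l l≤b)) ts-above)

-- All horizontal dominos of row `n` have top `n + 1`, which gives the common factor `fib (suc n)`
-- of their exponents.
rowSum-q : ∀ {m n} (p : Path m n) → [ fib (suc n) ]q ⊗ rowSum p ≋ [ fib (suc n) * fib (suc m) ]q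
rowSum-q {m} {n} p = Row.stripSum-q n (tileWeight (north p)) (λ _ → ≋-refl) (fib (suc n)) m
  λ i _ → ≡⇒≋ (cong q^_ (≡.trans
    (cong₂ (λ x y → fib x * fib y) (ℕ.+-comm i 2) (ℕ.+-comm n 1)) (ℕ.*-comm (fib (2 + i)) _)))

-- The power of `q` is the special domino, whose right end `m + 1` enters with index raised by one.
-- The ordinary dominos below it share the factor `fib (suc m)`.
columnSum-q : ∀ {m n} (p : Path m (suc n)) → [ fib (suc m) ]q ⊗ columnSum p
  ≋ (q^ (fib (2 + m) * fib (suc n))) ⊗ [ fib (suc m) * fib n ]q
-- A column of height 1 has no room for a special domino, hence no tiling; the right side vanishes
-- with `fib 0`.
columnSum-q {m} {zero} p = ≋-trans (⊗-zeroʳ [ fib (suc m) ]q)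
  (≋-sym (≋-trans (⊗-congʳ (q^ x) (≡⇒≋ (cong [_]q (ℕ.*-zeroʳ (fib (suc m)))))) (⊗-zeroʳ (q^ x))))
  where
  x : ℕ
  x = fib (2 + m) * 1
columnSum-q {m} {suc k} p = begin
  [ fib (suc m) ]q ⊗ columnSum p
    ≈⟨ ⊗-congʳ [ fib (suc m) ]q (Column.forcedDouble m w k) ⟩
  [ fib (suc m) ]q ⊗ (w (tile vertical m k) ⊗ Column.stripSum m w k)
    ≈⟨ ⊗-scaleˡ [ fib (suc m) ]q (Column.stripSum m w k) (w (tile vertical m k))
         (Column.stripSum-q m w (λ _ → ≋-refl) (fib (suc m)) k ordinary) ⟩
  w (tile vertical m k) ⊗ [ fib (suc m) * fib (suc k) ]q
    ≈⟨ ⊗-cong special ≋-refl ⟩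
  (q^ (fib (2 + m) * fib (2 + k))) ⊗ [ fib (suc m) * fib (suc k) ]q  ∎
  where
  w = tileWeight (east p)
  special : w (tile vertical m k) ≋ (q^ (fib (2 + m) * fib (2 + k)))
  special rewrite dec-true (touchesFromBelow? (east p) (tile vertical m k))
      (here ((ℕ.≤-refl , i<i+1) , ℕ.+-comm k 2)) =
    ≡⇒≋ (cong₂ (λ x y → q^ (fib (suc x) * fib y)) (ℕ.+-comm m 1) (ℕ.+-comm k 2))
  ordinary : ∀ i → suc i < k → w (tile vertical m i) ≋ (q^ (fib (suc m) * fib (2 + i)))
  -- The top is at most `k` while the step of this column has height `k + 2`; earlier steps lie in
  -- other columns.
  ordinary i i<k rewrite dec-false (touchesFromBelow? (east p) (tile vertical m i))
      (λ { (here (_ , t≡n)) → ℕ.<⇒≢ (s≤s (ℕ.m≤n⇒m≤1+n (i+2≤ i<k))) t≡n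
         ; (there touches) →
             let (a<m , _) , (m≤a , _) , _ = All.lookupAny (eastSteps-bounds p) touches
             in ℕ.<⇒≱ a<m m≤a }) =
    ≡⇒≋ (cong₂ (λ x y → q^ (fib x * fib y)) (ℕ.+-comm m 1) (ℕ.+-comm i 2))

-- The recursion for the Fibonomials

-- Both sides obey the Fibonacci recurrence in `m`, hence the two base cases.
fib-+ : ∀ m n → fib (suc m + n) ≡ fib (suc m) * fib (suc n) + fib m * fib n
fib-+ zero          n = ≡.sym (≡.trans (ℕ.+-identityʳ _) (ℕ.*-identityˡ (fib (suc n))))
fib-+ (suc zero)    n = ≡.sym (cong₂ _+_ (ℕ.*-identityˡ (fib (suc n))) (ℕ.*-identityˡ (fib n)))
fib-+ (suc (suc m)) n = ≡.trans (cong₂ _+_ (fib-+ (suc m) n) (fib-+ m n))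
  (regroup (fib (2 + m)) (fib (suc m)) (fib m) (fib (suc n)) (fib n))
  where
  regroup : ∀ x y z u v → (x * u + y * v) + (y * u + z * v) ≡ (x + y) * u + (y + z) * v
  regroup = solve-∀

[F]!-suc : ∀ n → [F suc n ]! ≋ [F n ]! ⊗ [ fib (suc n) ]q
[F]!-suc n = begin
  -- Unfolding `upTo` would expose the factor of `fib 1`; the new factor stands at the end.
  ∏ (map f (upTo (suc n)))      ≡⟨ cong (∏ ∘ map f) (upTo-∷ʳ n) ⟨
  ∏ (map f (upTo n ∷ʳ n))       ≡⟨ cong ∏ (map-++ f (upTo n) [ n ]) ⟩
  ∏ (map f (upTo n) ++ [ f n ])  ≈⟨ ∏-++ (map f (upTo n)) [ f n ] ⟩
  [F n ]! ⊗ (f n ⊗ 1ᴾ)          ≈⟨ ⊗-congʳ [F n ]! (⊗-identityʳ (f n)) ⟩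
  [F n ]! ⊗ f n                  ∎
  where
  f : ℕ → Poly
  f k = [ fib (suc k) ]q

pathsSum : ℕ → ℕ → Poly
pathsSum m n = ∑ (map pathSum (paths m n))

∑-map-step : ∀ {A B : Set} (f : B → Poly) (g : A → Poly) (h : A → B) p xs →
  (∀ x → p ⊗ f (h x) ≋ g x) → p ⊗ ∑ (map f (map h xs)) ≋ ∑ (map g xs)
∑-map-step f g h p xs e = begin
  p ⊗ ∑ (map f (map h xs))              ≡⟨ cong (λ ps → p ⊗ ∑ ps) (map-∘ xs) ⟨
  p ⊗ ∑ (map (f ∘ h) xs)                ≈⟨ ∑-⊗ p (f ∘ h) xs ⟨
  ∑ (map (λ x → p ⊗ f (h x)) xs)        ≈⟨ ∑-cong e xs ⟩
  ∑ (map _ xs)                          ∎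

-- By `columnSum-q` the factor of the last column depends on the end point alone, so it leaves the
-- sum over paths.
eastSum : ∀ m n → [ fib (suc m) ]q ⊗ ∑ (map pathSum (map east (paths m (suc n))))
  ≋ ((q^ (fib (2 + m) * fib (suc n))) ⊗ [ fib (suc m) * fib n ]q) ⊗ pathsSum m (suc n)
eastSum m n = ≋-trans
  (∑-map-step pathSum (λ p → c ⊗ pathSum p) east [ fib (suc m) ]q (paths m (suc n)) λ p → begin
    [ fib (suc m) ]q ⊗ pathSum (east p)
      ≈⟨ ⊗-congʳ [ fib (suc m) ]q (pathSum-east p) ⟩
    [ fib (suc m) ]q ⊗ (columnSum p ⊗ pathSum p)
      ≈⟨ ⊗-assoc [ fib (suc m) ]q (columnSum p) (pathSum p) ⟨
    ([ fib (suc m) ]q ⊗ columnSum p) ⊗ pathSum p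
      ≈⟨ ⊗-cong (columnSum-q p) ≋-refl ⟩
    c ⊗ pathSum p  ∎)
  (∑-⊗ c pathSum (paths m (suc n)))
  where
  c : Poly
  c = (q^ (fib (2 + m) * fib (suc n))) ⊗ [ fib (suc m) * fib n ]q

northSum : ∀ m n → [ fib (suc n) ]q ⊗ ∑ (map pathSum (map north (paths m n)))
  ≋ [ fib (suc n) * fib (suc m) ]q ⊗ pathsSum m n
northSum m n = ≋-trans
  (∑-map-step pathSum (λ p → c ⊗ pathSum p) north [ fib (suc n) ]q (paths m n) λ p → begin
    [ fib (suc n) ]q ⊗ pathSum (north p)
      ≈⟨ ⊗-congʳ [ fib (suc n) ]q (pathSum-north p) ⟩
    [ fib (suc n) ]q ⊗ (rowSum p ⊗ pathSum p)
      ≈⟨ ⊗-assoc [ fib (suc n) ]q (rowSum p) (pathSum p) ⟨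
    ([ fib (suc n) ]q ⊗ rowSum p) ⊗ pathSum p
      ≈⟨ ⊗-cong (rowSum-q p) ≋-refl ⟩
    c ⊗ pathSum p  ∎)
  (∑-⊗ c pathSum (paths m n))
  where
  c : Poly
  c = [ fib (suc n) * fib (suc m) ]q

∑-map-map : ∀ {A B : Set} (f : B → Poly) (g : A → Poly) (h : A → B) xs →
  (∀ x → f (h x) ≋ g x) → ∑ (map f (map h xs)) ≋ ∑ (map g xs)
∑-map-map f g h xs e = ≋-trans (≡⇒≋ (cong ∑ (≡.sym (map-∘ xs)))) (∑-cong e xs)

pathsSum-0ʳ : ∀ m → pathsSum m 0 ≋ 1ᴾ
pathsSum-0ʳ zero    = ≋-refl
pathsSum-0ʳ (suc m) = ≋-trans
  (∑-map-map pathSum pathSum east (paths m 0)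
    λ p → ≋-trans (pathSum-east p) (⊗-identityˡ (pathSum p)))
  (pathsSum-0ʳ m)

pathsSum-0ˡ : ∀ n → pathsSum 0 n ≋ 1ᴾ
pathsSum-0ˡ zero    = ≋-refl
pathsSum-0ˡ (suc n) = ≋-trans
  (∑-map-map pathSum pathSum north (paths 0 n)
    λ p → ≋-trans (pathSum-north p) (⊗-identityˡ (pathSum p)))
  (pathsSum-0ˡ n)

-- The borders are included because the recursion ends there: the rectangle is empty and its single
-- path has weight 1.
pathsSum-[F]! : ∀ m n → pathsSum m n ⊗ ([F m ]! ⊗ [F n ]!) ≋ [F m + n ]!
pathsSum-[F]! zero    n = begin
  pathsSum 0 n ⊗ (1ᴾ ⊗ [F n ]!)  ≈⟨ ⊗-cong (pathsSum-0ˡ n) (⊗-identityˡ [F n ]!) ⟩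
  1ᴾ ⊗ [F n ]!                    ≈⟨ ⊗-identityˡ [F n ]! ⟩
  [F n ]!                          ∎
pathsSum-[F]! (suc m) zero = begin
  pathsSum (suc m) 0 ⊗ ([F suc m ]! ⊗ 1ᴾ)
    ≈⟨ ⊗-cong (pathsSum-0ʳ (suc m)) (⊗-identityʳ [F suc m ]!) ⟩
  1ᴾ ⊗ [F suc m ]!  ≈⟨ ⊗-identityˡ [F suc m ]! ⟩
  [F suc m ]!       ≡⟨ cong [F_]! (ℕ.+-identityʳ (suc m)) ⟨
  [F suc m + 0 ]!   ∎
pathsSum-[F]! (suc m) (suc n) = begin
  pathsSum (suc m) (suc n) ⊗ ([F suc m ]! ⊗ [F suc n ]!)
    ≡⟨ cong (_⊗ ([F suc m ]! ⊗ [F suc n ]!))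
         (≡.trans (cong ∑ (map-++ pathSum (map east (paths m (suc n))) _))
           (∑-++ (map pathSum (map east (paths m (suc n)))) _)) ⟩
  (E ⊕ N) ⊗ ([F suc m ]! ⊗ [F suc n ]!)
    ≈⟨ ⊗-distribʳ-⊕ _ E N ⟩
  E ⊗ ([F suc m ]! ⊗ [F suc n ]!) ⊕ N ⊗ ([F suc m ]! ⊗ [F suc n ]!)
    ≈⟨ ⊕-cong eastPart northPart ⟩
  ((q^ x) ⊗ [ y ]q) ⊗ [F m + suc n ]! ⊕ [ x ]q ⊗ [F m + suc n ]!
    ≈⟨ ⊗-distribʳ-⊕ [F m + suc n ]! ((q^ x) ⊗ [ y ]q) [ x ]q ⟨
  ((q^ x) ⊗ [ y ]q ⊕ [ x ]q) ⊗ [F m + suc n ]!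
    ≡⟨ cong (_⊗ [F m + suc n ]!) (⊕-comm ((q^ x) ⊗ [ y ]q) [ x ]q) ⟩
  ([ x ]q ⊕ (q^ x) ⊗ [ y ]q) ⊗ [F m + suc n ]!
    ≈⟨ ⊗-cong ([+]q x y) ≋-refl ⟨
  [ x + y ]q ⊗ [F m + suc n ]!
    ≡⟨ cong (λ k → [ k ]q ⊗ [F m + suc n ]!)
         (≡.trans (≡.sym (fib-+ (suc m) n)) (cong (fib ∘ suc) (≡.sym (ℕ.+-suc m n)))) ⟩
  [ fib (suc (m + suc n)) ]q ⊗ [F m + suc n ]!
    ≈⟨ ⊗-comm _ [F m + suc n ]! ⟩
  [F m + suc n ]! ⊗ [ fib (suc (m + suc n)) ]q
    ≈⟨ [F]!-suc (m + suc n) ⟨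
  [F suc m + suc n ]!  ∎
  where
  x y : ℕ
  x = fib (2 + m) * fib (suc n)
  y = fib (suc m) * fib n
  E N : Poly
  E = ∑ (map pathSum (map east (paths m (suc n))))
  N = ∑ (map pathSum (map north (paths (suc m) n)))
  -- `b` is the last factor of the larger factorial. It turns the sum `s` into `d` times a smaller
  -- sum `g`, and the other factors `a` meet `g` in the induction hypothesis.
  pull : ∀ s a b g h d → b ⊗ s ≋ d ⊗ g → g ⊗ a ≋ h → s ⊗ (a ⊗ b) ≋ d ⊗ h
  pull s a b g h d e e′ = begin
    s ⊗ (a ⊗ b)  ≈⟨ ⊗-leftSwap s a b ⟩
    a ⊗ (s ⊗ b)  ≈⟨ ⊗-congʳ a (≋-trans (⊗-comm s b) e) ⟩
    a ⊗ (d ⊗ g)  ≈⟨ ⊗-leftSwap a d g ⟩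
    d ⊗ (a ⊗ g)  ≈⟨ ⊗-congʳ d (≋-trans (⊗-comm a g) e′) ⟩
    d ⊗ h        ∎
  eastPart : E ⊗ ([F suc m ]! ⊗ [F suc n ]!) ≋ ((q^ x) ⊗ [ y ]q) ⊗ [F m + suc n ]!
  eastPart = begin
    E ⊗ ([F suc m ]! ⊗ [F suc n ]!)
      ≈⟨ ⊗-congʳ E (⊗-cong ([F]!-suc m) ≋-refl) ⟩
    E ⊗ (([F m ]! ⊗ [ fib (suc m) ]q) ⊗ [F suc n ]!)
      ≈⟨ ⊗-congʳ E (≋-trans (⊗-assoc [F m ]! [ fib (suc m) ]q [F suc n ]!)
           (≋-trans (⊗-congʳ [F m ]! (⊗-comm [ fib (suc m) ]q [F suc n ]!))
             (≋-sym (⊗-assoc [F m ]! [F suc n ]! [ fib (suc m) ]q)))) ⟩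
    E ⊗ (([F m ]! ⊗ [F suc n ]!) ⊗ [ fib (suc m) ]q)
      ≈⟨ pull E ([F m ]! ⊗ [F suc n ]!) [ fib (suc m) ]q (pathsSum m (suc n)) [F m + suc n ]!
           ((q^ x) ⊗ [ y ]q) (eastSum m n) (pathsSum-[F]! m (suc n)) ⟩
    ((q^ x) ⊗ [ y ]q) ⊗ [F m + suc n ]!  ∎
  northPart : N ⊗ ([F suc m ]! ⊗ [F suc n ]!) ≋ [ x ]q ⊗ [F m + suc n ]!
  northPart = begin
    N ⊗ ([F suc m ]! ⊗ [F suc n ]!)
      ≈⟨ ⊗-congʳ N (≋-trans (⊗-congʳ [F suc m ]! ([F]!-suc n))
           (≋-sym (⊗-assoc [F suc m ]! [F n ]! [ fib (suc n) ]q))) ⟩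
    N ⊗ (([F suc m ]! ⊗ [F n ]!) ⊗ [ fib (suc n) ]q)
      ≈⟨ pull N ([F suc m ]! ⊗ [F n ]!) [ fib (suc n) ]q (pathsSum (suc m) n) [F m + suc n ]! [ x ]q
           (≋-trans (northSum (suc m) n)
             (≡⇒≋ (cong (λ k → [ k ]q ⊗ pathsSum (suc m) n)
               (ℕ.*-comm (fib (suc n)) (fib (2 + m))))))
           (≋-trans (pathsSum-[F]! (suc m) n) (≡⇒≋ (cong [F_]! (≡.sym (ℕ.+-suc m n))))) ⟩
    [ x ]q ⊗ [F m + suc n ]!  ∎

∑-𝒯 : ∀ m n → ∑ (map ω (𝒯 m n)) ≋ pathsSum m n
∑-𝒯 m n = begin
  ∑ (map ω (𝒯 m n))
    ≈⟨ ∑-filter (uncurry isPathDominoTiling?) ω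
         (cartesianProduct (paths m n) (sublists (tiles m n))) ⟩
  ∑ (map (λ x → gate (uncurry isPathDominoTiling? x) (ω x))
    (cartesianProduct (paths m n) (sublists (tiles m n))))
    ≈⟨ ∑-cartesianProduct (λ x → gate (uncurry isPathDominoTiling? x) (ω x))
         (paths m n) (sublists (tiles m n)) ⟩
  ∑ (map (λ p → ∑ (map (λ ts → gate (isPathDominoTiling? p ts) (ω (p , ts)))
      (sublists (tiles m n)))) (paths m n))
    ≈⟨ ∑-cong (λ p → ≋-trans (∑-sublists _ (tiles m n)) (∑-tilings p)) (paths m n) ⟩
  pathsSum m n  ∎

-- Non-negativity

nonNegative-∷ : ∀ {a p} → 0ℤ ℤ.≤ a → NonNegativeCoefficients p →
  NonNegativeCoefficients (a ∷ p)
nonNegative-∷ 0≤a 0≤p zero    = 0≤a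
nonNegative-∷ 0≤a 0≤p (suc k) = 0≤p k

0≤0 : 0ℤ ℤ.≤ 0ℤ
0≤0 = ℤ.≤-refl

nonNegative-1 : NonNegativeCoefficients 1ᴾ
nonNegative-1 = nonNegative-∷ (ℤ.+≤+ z≤n) (λ _ → 0≤0)

nonNegative-q^ : ∀ k → NonNegativeCoefficients (q^ k)
nonNegative-q^ zero    = nonNegative-1
nonNegative-q^ (suc k) = nonNegative-∷ 0≤0 (nonNegative-q^ k)

nonNegative-⊕ : ∀ {p r} → NonNegativeCoefficients p → NonNegativeCoefficients r →
  NonNegativeCoefficients (p ⊕ r)
nonNegative-⊕ {p} {r} 0≤p 0≤r k =
  subst (0ℤ ℤ.≤_) (≡.sym (coeff-⊕ p r k)) (ℤ.+-mono-≤ (0≤p k) (0≤r k))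

nonNegative-scale : ∀ {a p} → 0ℤ ℤ.≤ a → NonNegativeCoefficients p →
  NonNegativeCoefficients (scale a p)
nonNegative-scale {a} {p} 0≤a 0≤p k = subst (0ℤ ℤ.≤_) (≡.sym (coeff-scale a p k))
  (subst (ℤ._≤ a ℤ.* coeff p k) (ℤ.*-zeroʳ a)
    (ℤ.*-monoˡ-≤-nonNeg a {{ℤ.nonNegative 0≤a}} (0≤p k)))

nonNegative-⊗ : ∀ p {r} → NonNegativeCoefficients p → NonNegativeCoefficients r →
  NonNegativeCoefficients (p ⊗ r)
nonNegative-⊗ []      0≤p 0≤r = λ _ → 0≤0
nonNegative-⊗ (a ∷ p) {r} 0≤p 0≤r = nonNegative-⊕ {scale a r} {0ℤ ∷ p ⊗ r}
  (nonNegative-scale {a} {r} (0≤p 0) 0≤r)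
  (nonNegative-∷ {0ℤ} {p ⊗ r} 0≤0 (nonNegative-⊗ p (0≤p ∘ suc) 0≤r))

nonNegative-∑ : ∀ {A : Set} (f : A → Poly) → (∀ x → NonNegativeCoefficients (f x)) →
  ∀ xs → NonNegativeCoefficients (∑ (map f xs))
nonNegative-∑ f 0≤f []       = λ _ → 0≤0
nonNegative-∑ f 0≤f (x ∷ xs) =
  nonNegative-⊕ {f x} {∑ (map f xs)} (0≤f x) (nonNegative-∑ f 0≤f xs)

nonNegative-∏ : ∀ {A : Set} (f : A → Poly) → (∀ x → NonNegativeCoefficients (f x)) →
  ∀ xs → NonNegativeCoefficients (∏ (map f xs))
nonNegative-∏ f 0≤f []       = nonNegative-1
nonNegative-∏ f 0≤f (x ∷ xs) =
  nonNegative-⊗ (f x) (0≤f x) (nonNegative-∏ f 0≤f xs)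

nonNegative-tileWeight : ∀ {m n} (p : Path m n) t →
  NonNegativeCoefficients (tileWeight p t)
nonNegative-tileWeight p (tile monomino   _ _) = nonNegative-1
nonNegative-tileWeight p (tile horizontal a b) =
  nonNegative-q^ (fib (a + 2) * fib (b + 1))
nonNegative-tileWeight p (tile vertical   a b)
  with does (touchesFromBelow? p (tile vertical a b))
... | true  = nonNegative-q^ (fib (suc (a + 1)) * fib (b + 2))
... | false = nonNegative-q^ (fib (a + 1) * fib (b + 2))

nonNegative-∑ω : ∀ m n → NonNegativeCoefficients (∑ (map ω (𝒯 m n)))
nonNegative-∑ω m n = nonNegative-∑ ω
  (λ (p , ts) → nonNegative-∏ (tileWeight p) (nonNegative-tileWeight p) ts) (𝒯 m n)

theorem2p4 : ∀ (m n : ℕ) .{{_ : NonZero m}} .{{_ : NonZero n}} →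
    (∃[ p ] (NonNegativeCoefficients p × qFibonomial m n ≃ fromPoly p))
    × qFibonomial m n ≃ fromPoly (∑ (map ω (𝒯 m n)))
theorem2p4 m n =
  -- The tiling sum itself is the polynomial witness, so one identity proves both claims.
  (∑ (map ω (𝒯 m n)) , nonNegative-∑ω m n , qFibonomial≃∑ω) , qFibonomial≃∑ω
  where
  qFibonomial≃∑ω : qFibonomial m n ≃ fromPoly (∑ (map ω (𝒯 m n)))
  qFibonomial≃∑ω = equalCoeffs (begin
    [F m + n ]! ⊗ 1ᴾ
      ≈⟨ ⊗-identityʳ [F m + n ]! ⟩
    [F m + n ]!
      ≈⟨ pathsSum-[F]! m n ⟨
    pathsSum m n ⊗ ([F m ]! ⊗ [F n ]!)
      ≈⟨ ⊗-cong (∑-𝒯 m n) ≋-refl ⟨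
    ∑ (map ω (𝒯 m n)) ⊗ ([F m ]! ⊗ [F n ]!)  ∎)
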